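{- For all integers $\alpha \geq 0$ and $n \geq 0$, and for each $i \in \{1,2,3,4\}$, $$\mathrm{RD}^{(4,9)}\left(6 \cdot 5^{2\alpha+2}n + 6 \cdot 5^{2\alpha+1}i + 5^{2\alpha+2} + 1\right) \equiv 0 \pmod{6}.$$
   Context: For a nonnegative integer $n$, $\mathrm{RD}^{(4,9)}(n)$ denotes the number of partitions of $n$ into parts that are simultaneously 4-regular and 9-distinct, i.e., partitions of $n$ in which no part is divisible by $4$ and each distinct part appears at least once and at most $8$ times. Equivalently, writing $f_k = \prod_{m\ge1}(1-q^{km})$, $\sum_{n\ge0}\mathrm{RD}^{(4,9)}(n)q^n = \frac{f_9 f_4}{f_1 f_{36}}$. -}

module Defs where

open import Data.Nat using (ℕ; zero; suc; _+_; _*_; _∸_; _≤?_; _%_)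
open import Data.Nat.Divisibility using (_∣?_)
open import Data.List using (List; map; upTo)
open import Data.Nat.ListAction using (sum)
open import Relation.Nullary using (yes; no)

-- A partition of r into parts from {1,…,k} is determined by its multiplicity
-- function m ↦ (number of times m occurs).  The partition is 4-regular and
-- 9-distinct iff every part with nonzero multiplicity is not divisible by 4
-- and every multiplicity is at most 8.
--
-- count k r = number of partitions of r with all parts in {1,…,k},
-- no part divisible by 4, and each part occurring at most 8 times.
-- Recursion on the largest allowed part size k: choose its multiplicity j.
count : ℕ → ℕ → ℕ
count zero zero = 1
count zero (suc r) = 0
count (suc k) r with 4 ∣? suc k
... | yes _ = count k r
... | no _ = sum (map step (upTo 9))
  where
  step : ℕ → ℕ
  step j with j * suc k ≤? r
  ... | yes _ = count k (r ∸ j * suc k)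
  ... | no _ = 0

-- RD^(4,9)(n): parts of a partition of n are at most n.
RD49 : ℕ → ℕ
RD49 n = count n n

{-# OPTIONS --safe #-}
module Submission where

-- Write f k for ∏ (1 − q^(k m)) and θ a b for Σ_j q^(a j(j+1)/2 + b j(j−1)/2), j over the integers.
-- By the Jacobi triple product, the generating function of RD49 is θ 1 2 · θ 2 4 times a series in q³.
-- Multiplication by 1 + √−2 maps the representations of n by the exponents of θ 0 3 · θ 1 5
-- bijectively onto those of 3n + 2 by the exponents of θ 1 2 · θ 2 4. Rewriting these theta series
-- as products gives, for H = Σ RD49 (3n + 2) q^n, the identity f 1 ³ · H = 2 · f 2 · f 3 · f 6.
-- So H is even, and H ≡ 2 · f 2 · f 6 modulo 3 because f 1 ³ ≡ f 3. By the pentagonal number theorem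
-- the coefficient of q^(2M) in f 2 · f 6 vanishes unless 4 (6M + 1) = x² + 3y²; as −3 is a
-- non-residue modulo 5, a number of this form has even 5-adic valuation, whereas here the valuation
-- of 6M + 1 is 2α + 1.

open import Defs
open import Data.Nat using (ℕ; _+_; _*_; _^_; _≤_)
open import Data.Nat.Divisibility using (_∣_)

open import Algebra.Bundles using (CommutativeRing)
import Algebra.Solver.Ring
open import Algebra.Solver.Ring.AlmostCommutativeRing using (_-Raw-AlmostCommutative⟶_; fromCommutativeRing)
open import Algebra.Structures using (IsAbelianGroup)
open import Data.Fin using (Fin; toℕ)
import Data.Fin.Properties as Finₚ
open import Data.Integer using (ℤ; +_; -[1+_]; _⊖_; ∣_∣)
import Data.Integer as Z
import Data.Integer.Divisibility.Signed as ℤ∣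
import Data.Integer.Properties as ℤₚ
import Data.Integer.Solver
import Data.Integer.Tactic.RingSolver as ℤTactic
open import Data.List using (List; []; _∷_; _++_; upTo; map; filter; length; cartesianProduct)
open import Data.List.Membership.Propositional using (_∈_)
open import Data.List.Membership.Propositional.Properties
  using (∈-filter⁺; ∈-filter⁻; ∈-cartesianProduct⁺; ∈-map⁺; ∈-map⁻)
open import Data.List.Membership.Propositional.Properties.WithK using (unique∧set⇒bag)
import Data.List.Properties as Listₚ
open import Data.List.Relation.Binary.BagAndSetEquality using (∼bag⇒↭)
open import Data.List.Relation.Binary.Permutation.Propositional.Properties using (↭-length)
open import Data.List.Relation.Unary.All using (All; []; _∷_)
import Data.List.Relation.Unary.All as All
open import Data.List.Relation.Unary.AllPairs using ([]; _∷_)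
open import Data.List.Relation.Unary.Any using (here; there)
open import Data.List.Relation.Unary.Unique.Propositional using (Unique)
import Data.List.Relation.Unary.Unique.Propositional.Properties as Uniqueₚ
import Data.Maybe as Maybe
open import Data.Nat using (zero; suc; _∸_; _<_; z≤n; s≤s; NonZero; _≤?_; _≟_)
open import Data.Nat.Coprimality using (coprime-divisor; coprime?)
open import Data.Nat.Divisibility using (_∣?_)
import Data.Nat.Divisibility as ℕ∣
open import Data.Nat.DivMod using (_divMod_; result)
open import Data.Nat.Induction using (<-rec)
import Data.Nat.Properties as ℕₚ
open import Data.Nat.Solver using (module +-*-Solver)
open import Data.Nat.Tactic.RingSolver using (solve-∀)
open import Data.Product using (_×_; _,_; proj₁; proj₂; Σ)
open import Data.Sum using (_⊎_; inj₁; inj₂)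
open import Function.Bundles using (mk⇔)
open import Level using (0ℓ)
open import Relation.Binary.PropositionalEquality using (_≡_; refl; sym; trans; cong; cong₂; subst; module ≡-Reasoning)
import Relation.Binary.Reasoning.Setoid as SetoidReasoning
open import Relation.Nullary using (yes; no; ¬_; Dec; contradiction)
open import Relation.Nullary.Decidable using (from-yes; from-no; dec⇒maybe; _→-dec_; _×-dec_)

-- The ring of formal power series

-- No series is ever inverted: quotients are stated with denominators cleared, and factors with
-- constant term 1 are cancelled by induction on coefficients. Infinite products and bilateral sums
-- are compared modulo q^N for every N. The theta factors come from solving their product formulas
-- for f 4 / f 1: the generating function f 9 · f 4 / (f 1 · f 36) becomes θ 1 2 · θ 2 4 · f 9 · f
-- 12 / (f 3 ² · f 6 · f 36), so extracting the exponents 2 modulo 3 concerns the thetas alone.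
-- Completing squares, an exponent e of θ 1 2 · θ 2 4 satisfies 24 e + 3 = u² + 2 v², and one of θ 0
-- 3 · θ 1 5 satisfies 24 e + 17 = x² + 2 y². For exponents 3 n + 2 and n the right sides differ by
-- the factor 3, the norm of 1 + √-2. The factor 2 in the identity for H reflects the symmetry j ↦ 1
-- - j of the exponents 3 j (j - 1) / 2 of θ 0 3.

Series : Set
Series = ℕ → ℤ

infix 4 _≈_
-- A record rather than a bare pointwise equality, so that both series can be recovered from the
-- type of a proof.
record _≈_ (X Y : Series) : Set where
  constructor mk
  field at : ∀ n → X n ≡ Y n
open _≈_ public

tail : Series → Series
tail X n = X (suc n)

infixl 6 _+ˢ_
infixl 7 _*ˢ_
infix 8 -ˢ_

const : ℤ → Series
const c zero = c
const c (suc n) = + 0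

0ˢ 1ˢ : Series
0ˢ = const (+ 0)
1ˢ = const (+ 1)

-- Opaque, since an unfolded pointwise sum does not determine its summands by unification.
opaque
  _+ˢ_ : Series → Series → Series
  (X +ˢ Y) n = X n Z.+ Y n

  -ˢ_ : Series → Series
  (-ˢ X) n = Z.- X n

  +ˢ-at : ∀ X Y n → (X +ˢ Y) n ≡ X n Z.+ Y n
  +ˢ-at X Y n = refl

  -ˢ-at : ∀ X n → (-ˢ X) n ≡ Z.- X n
  -ˢ-at X n = refl

_*ˢ_ : Series → Series → Series
(X *ˢ Y) zero = X 0 Z.* Y 0
(X *ˢ Y) (suc n) = X 0 Z.* Y (suc n) Z.+ (tail X *ˢ Y) n

module ℤSolver = Data.Integer.Solver.+-*-Solver

0ˢ-at : ∀ n → 0ˢ n ≡ + 0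
0ˢ-at zero = refl
0ˢ-at (suc n) = refl

*ˢ-at-cong : ∀ {X X′ Y Y′} n → (∀ m → m ≤ n → X m ≡ X′ m) → (∀ m → m ≤ n → Y m ≡ Y′ m) →
  (X *ˢ Y) n ≡ (X′ *ˢ Y′) n
*ˢ-at-cong zero p q = cong₂ Z._*_ (p 0 z≤n) (q 0 z≤n)
*ˢ-at-cong (suc n) p q = cong₂ Z._+_ (cong₂ Z._*_ (p 0 z≤n) (q (suc n) ℕₚ.≤-refl))
  (*ˢ-at-cong n (λ m m≤n → p (suc m) (s≤s m≤n)) (λ m m≤n → q m (ℕₚ.m≤n⇒m≤1+n m≤n)))

-- The definition of the product peels off the head of the left factor, this equation the head of
-- the right one; comparing the two recursions gives commutativity.
*ˢ-suc : ∀ X Y n → (X *ˢ Y) (suc n) ≡ (X *ˢ tail Y) n Z.+ X (suc n) Z.* Y 0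
*ˢ-suc X Y zero = refl
*ˢ-suc X Y (suc n) = trans (cong (Z._+_ (X 0 Z.* Y (suc (suc n)))) (*ˢ-suc (tail X) Y n))
  (sym (ℤₚ.+-assoc (X 0 Z.* Y (suc (suc n))) _ _))

*ˢ-comm-at : ∀ X Y n → (X *ˢ Y) n ≡ (Y *ˢ X) n
*ˢ-comm-at X Y zero = ℤₚ.*-comm (X 0) (Y 0)
*ˢ-comm-at X Y (suc n) = begin
  X 0 Z.* Y (suc n) Z.+ (tail X *ˢ Y) n ≡⟨ cong₂ Z._+_ (ℤₚ.*-comm (X 0) _) (*ˢ-comm-at (tail X) Y n) ⟩
  Y (suc n) Z.* X 0 Z.+ (Y *ˢ tail X) n ≡⟨ ℤₚ.+-comm (Y (suc n) Z.* X 0) _ ⟩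
  (Y *ˢ tail X) n Z.+ Y (suc n) Z.* X 0 ≡⟨ *ˢ-suc Y X n ⟨
  (Y *ˢ X) (suc n) ∎
  where open ≡-Reasoning

scale-*ˢ-at : ∀ c X Y n → ((λ m → c Z.* X m) *ˢ Y) n ≡ c Z.* (X *ˢ Y) n
scale-*ˢ-at c X Y zero = ℤₚ.*-assoc c (X 0) (Y 0)
scale-*ˢ-at c X Y (suc n) = trans (cong (Z._+_ (c Z.* X 0 Z.* Y (suc n))) (scale-*ˢ-at c (tail X) Y n))
  (ℤSolver.solve 4 (λ c x y a → c :* x :* y :+ c :* a := c :* (x :* y :+ a)) refl c (X 0) (Y (suc n)) _)
  where open ℤSolver

opaque
  unfolding _+ˢ_ -ˢ_

  *ˢ-distribʳ-at : ∀ Z X Y n → ((X +ˢ Y) *ˢ Z) n ≡ (X *ˢ Z) n Z.+ (Y *ˢ Z) n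
  *ˢ-distribʳ-at Z X Y zero = ℤₚ.*-distribʳ-+ (Z 0) (X 0) (Y 0)
  *ˢ-distribʳ-at Z X Y (suc n) =
    trans (cong (Z._+_ ((X 0 Z.+ Y 0) Z.* Z (suc n))) (*ˢ-distribʳ-at Z (tail X) (tail Y) n))
      (ℤSolver.solve 5 (λ x y z a b → (x :+ y) :* z :+ (a :+ b) := (x :* z :+ a) :+ (y :* z :+ b)) refl
        (X 0) (Y 0) (Z (suc n)) _ _)
    where open ℤSolver

  *ˢ-assoc-at : ∀ X Y Z n → ((X *ˢ Y) *ˢ Z) n ≡ (X *ˢ (Y *ˢ Z)) n
  *ˢ-assoc-at X Y Z zero = ℤₚ.*-assoc (X 0) (Y 0) (Z 0)
  *ˢ-assoc-at X Y Z (suc n) = begin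
    -- By definition, `tail (X *ˢ Y)` is the sum in parentheses.
    X 0 Z.* Y 0 Z.* Z (suc n) Z.+ (((λ m → X 0 Z.* tail Y m) +ˢ tail X *ˢ Y) *ˢ Z) n
      ≡⟨ cong (Z._+_ (X 0 Z.* Y 0 Z.* Z (suc n)))
           (trans (*ˢ-distribʳ-at Z (λ m → X 0 Z.* tail Y m) (tail X *ˢ Y) n)
             (cong₂ Z._+_ (scale-*ˢ-at (X 0) (tail Y) Z n) (*ˢ-assoc-at (tail X) Y Z n))) ⟩
    X 0 Z.* Y 0 Z.* Z (suc n) Z.+ (X 0 Z.* (tail Y *ˢ Z) n Z.+ (tail X *ˢ (Y *ˢ Z)) n)
      ≡⟨ ℤSolver.solve 5 (λ x y z a b → x :* y :* z :+ (x :* a :+ b) := x :* (y :* z :+ a) :+ b) refl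
           (X 0) (Y 0) (Z (suc n)) _ _ ⟩
    X 0 Z.* (Y *ˢ Z) (suc n) Z.+ (tail X *ˢ (Y *ˢ Z)) n ∎
    where
    open ≡-Reasoning
    open ℤSolver

  +ˢ-isAbelianGroup : IsAbelianGroup _≈_ _+ˢ_ 0ˢ -ˢ_
  +ˢ-isAbelianGroup = record
      { isGroup = record
        { isMonoid = record
          { isSemigroup = record
            { isMagma = record
              { isEquivalence = record
                { refl = mk λ _ → refl
                ; sym = λ p → mk λ n → sym (at p n)
                ; trans = λ p q → mk λ n → trans (at p n) (at q n) }
              ; ∙-cong = λ p q → mk λ n → cong₂ Z._+_ (at p n) (at q n) }
            ; assoc = λ X Y Z → mk λ n → ℤₚ.+-assoc (X n) (Y n) (Z n) }
          ; identity = (λ X → mk λ n → trans (cong (Z._+ X n) (0ˢ-at n)) (ℤₚ.+-identityˡ (X n)))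
                     , (λ X → mk λ n → trans (cong (Z._+_ (X n)) (0ˢ-at n)) (ℤₚ.+-identityʳ (X n))) }
        ; inverse = (λ X → mk λ n → trans (ℤₚ.+-inverseˡ (X n)) (sym (0ˢ-at n)))
                  , (λ X → mk λ n → trans (ℤₚ.+-inverseʳ (X n)) (sym (0ˢ-at n)))
        ; ⁻¹-cong = λ p → mk λ n → cong Z.-_ (at p n) }
      ; comm = λ X Y → mk λ n → ℤₚ.+-comm (X n) (Y n) }

0-*ˢ-at : ∀ X Y n → (∀ m → X m ≡ + 0) → (X *ˢ Y) n ≡ + 0
0-*ˢ-at X Y zero X≡0 = cong (Z._* Y 0) (X≡0 0)
0-*ˢ-at X Y (suc n) X≡0 = cong₂ Z._+_ (cong (Z._* Y (suc n)) (X≡0 0))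
  (0-*ˢ-at (tail X) Y n (λ m → X≡0 (suc m)))

const-*ˢ-at : ∀ c X n → (const c *ˢ X) n ≡ c Z.* X n
const-*ˢ-at c X zero = refl
const-*ˢ-at c X (suc n) = trans (cong (Z._+_ (c Z.* X (suc n))) (0-*ˢ-at _ X n (λ _ → refl))) (ℤₚ.+-identityʳ _)

seriesRing : CommutativeRing 0ℓ 0ℓ
seriesRing = record
  { Carrier = Series ; _≈_ = _≈_ ; _+_ = _+ˢ_ ; _*_ = _*ˢ_ ; -_ = -ˢ_ ; 0# = 0ˢ ; 1# = 1ˢ
  ; isCommutativeRing = record
    { isRing = record
      { +-isAbelianGroup = +ˢ-isAbelianGroup
      ; *-cong = λ p q → mk λ n → *ˢ-at-cong n (λ m _ → at p m) (λ m _ → at q m)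
      ; *-assoc = λ X Y Z → mk (*ˢ-assoc-at X Y Z)
      ; *-identity = 1-*ˢ , (λ X → mk λ n → trans (*ˢ-comm-at X 1ˢ n) (at (1-*ˢ X) n))
      ; distrib = (λ X Y Z → mk λ n → trans (*ˢ-comm-at X (Y +ˢ Z) n) (trans (*ˢ-distribʳ-at X Y Z n)
                    (trans (cong₂ Z._+_ (*ˢ-comm-at Y X n) (*ˢ-comm-at Z X n)) (sym (+ˢ-at (X *ˢ Y) (X *ˢ Z) n)))))
                , (λ X Y Z → mk λ n → trans (*ˢ-distribʳ-at X Y Z n) (sym (+ˢ-at (Y *ˢ X) (Z *ˢ X) n)))
      }
    ; *-comm = λ X Y → mk (*ˢ-comm-at X Y)
    }
  }
  where
  1-*ˢ : ∀ X → 1ˢ *ˢ X ≈ X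
  1-*ˢ X = mk λ n → trans (const-*ˢ-at (+ 1) X n) (ℤₚ.*-identityˡ (X n))

module S = CommutativeRing seriesRing

const-morphism : Z.+-*-rawRing -Raw-AlmostCommutative⟶ fromCommutativeRing seriesRing
const-morphism = record
  { ⟦_⟧ = const
  ; +-homo = λ c d → mk λ { zero → sym (+ˢ-at _ _ 0) ; (suc n) → sym (+ˢ-at _ _ (suc n)) }
  ; *-homo = λ c d → mk λ { zero → refl ; (suc n) → sym (trans (const-*ˢ-at c (const d) (suc n)) (ℤₚ.*-zeroʳ c)) }
  ; -‿homo = λ c → mk λ { zero → sym (-ˢ-at _ 0) ; (suc n) → sym (-ˢ-at _ (suc n)) }
  ; 0-homo = S.refl
  ; 1-homo = S.refl
  }

const-≟ : ∀ c d → Maybe.Maybe (const c ≈ const d)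
const-≟ c d = Maybe.map (λ c≡d → S.reflexive (cong const c≡d)) (dec⇒maybe (c ℤₚ.≟ d))

module SeriesSolver = Algebra.Solver.Ring Z.+-*-rawRing (fromCommutativeRing seriesRing) const-morphism const-≟

-- Truncation, infinite products and Gaussian binomials

module ≈-Reasoning = SetoidReasoning S.setoid

infix 4 _≈[_]_

-- Congruence modulo q^N, the tool for passing from finite products and sums to infinite ones.
record _≈[_]_ (X : Series) (N : ℕ) (Y : Series) : Set where
  constructor mk
  field below : ∀ n → n < N → X n ≡ Y n
open _≈[_]_ public

≈⇒≈[] : ∀ {N X Y} → X ≈ Y → X ≈[ N ] Y
≈⇒≈[] p = mk λ n _ → at p n

≈[]⇒≈ : ∀ {X Y} → (∀ N → X ≈[ N ] Y) → X ≈ Y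
≈[]⇒≈ p = mk λ n → below (p (suc n)) n ℕₚ.≤-refl

≈[]-refl : ∀ {N X} → X ≈[ N ] X
≈[]-refl = mk λ _ _ → refl

≈[]-sym : ∀ {N X Y} → X ≈[ N ] Y → Y ≈[ N ] X
≈[]-sym p = mk λ n n<N → sym (below p n n<N)

≈[]-trans : ∀ {N X Y Z} → X ≈[ N ] Y → Y ≈[ N ] Z → X ≈[ N ] Z
≈[]-trans p q = mk λ n n<N → trans (below p n n<N) (below q n n<N)

≈[]-≤ : ∀ {M N X Y} → M ≤ N → X ≈[ N ] Y → X ≈[ M ] Y
≈[]-≤ M≤N p = mk λ n n<M → below p n (ℕₚ.≤-trans n<M M≤N)

+ˢ-cong[] : ∀ {N X X′ Y Y′} → X ≈[ N ] X′ → Y ≈[ N ] Y′ → X +ˢ Y ≈[ N ] X′ +ˢ Y′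
+ˢ-cong[] p q = mk λ n n<N → trans (+ˢ-at _ _ n) (trans (cong₂ Z._+_ (below p n n<N) (below q n n<N)) (sym (+ˢ-at _ _ n)))

*ˢ-cong[] : ∀ {N X X′ Y Y′} → X ≈[ N ] X′ → Y ≈[ N ] Y′ → X *ˢ Y ≈[ N ] X′ *ˢ Y′
*ˢ-cong[] p q = mk λ n n<N → *ˢ-at-cong n
  (λ m m≤n → below p m (ℕₚ.≤-<-trans m≤n n<N)) (λ m m≤n → below q m (ℕₚ.≤-<-trans m≤n n<N))

-- As X 0 = 1, the coefficient of q^n in X · Y is Y n plus a combination of earlier coefficients of
-- Y, so strong induction applies. The case d = 0 is cancellation of X; d = 2 and d = 3 yield the
-- final congruences.
∣-cancel : ∀ d X Y N → X 0 ≡ + 1 → (∀ n → n < N → d ℤ∣.∣ (X *ˢ Y) n) → ∀ n → n < N → d ℤ∣.∣ Y n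
∣-cancel d X Y N X0≡1 d∣XY = <-rec (λ n → n < N → d ℤ∣.∣ Y n) step
  where
  ∣-later : ∀ W n → (∀ m → m ≤ n → d ℤ∣.∣ Y m) → d ℤ∣.∣ (W *ˢ Y) n
  ∣-later W zero p = ℤ∣.∣n⇒∣m*n (W 0) (p 0 z≤n)
  ∣-later W (suc n) p = ℤ∣.∣m∣n⇒∣m+n (ℤ∣.∣n⇒∣m*n (W 0) (p (suc n) ℕₚ.≤-refl))
    (∣-later (tail W) n (λ m m≤n → p m (ℕₚ.m≤n⇒m≤1+n m≤n)))

  head : ∀ n → X 0 Z.* Y n ≡ Y n
  head n = trans (cong (Z._* Y n) X0≡1) (ℤₚ.*-identityˡ (Y n))

  step : ∀ n → (∀ {m} → m < n → m < N → d ℤ∣.∣ Y m) → n < N → d ℤ∣.∣ Y n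
  step zero rec 0<N = subst (d ℤ∣.∣_) (head 0) (d∣XY 0 0<N)
  step (suc n) rec n<N = subst (d ℤ∣.∣_) (head (suc n))
    (ℤ∣.∣m+n∣m⇒∣n (subst (d ℤ∣.∣_) (ℤₚ.+-comm (X 0 Z.* Y (suc n)) _) (d∣XY (suc n) n<N))
      (∣-later (tail X) n (λ m m≤n → rec (s≤s m≤n) (ℕₚ.≤-<-trans (ℕₚ.m≤n⇒m≤1+n m≤n) n<N))))

*ˢ-cancelˡ[] : ∀ {N} X {Y Y′} → X 0 ≡ + 1 → X *ˢ Y ≈[ N ] X *ˢ Y′ → Y ≈[ N ] Y′
*ˢ-cancelˡ[] {N} X {Y} {Y′} X0≡1 p = mk λ n n<N → ℤₚ.i-j≡0⇒i≡j (Y n) (Y′ n)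
  (trans (sym (trans (+ˢ-at Y (-ˢ Y′) n) (cong (Z._+_ (Y n)) (-ˢ-at Y′ n)))) (ℤ∣.0∣⇒≡0 (∣-cancel (+ 0) X (Y +ˢ -ˢ Y′) N X0≡1 zero-below n n<N)))
  where
  open SeriesSolver
  difference : ∀ n → (X *ˢ Y +ˢ -ˢ (X *ˢ Y′)) n ≡ (X *ˢ Y) n Z.+ Z.- (X *ˢ Y′) n
  difference n = trans (+ˢ-at _ _ n) (cong (Z._+_ ((X *ˢ Y) n)) (-ˢ-at _ n))

  zero-below : ∀ n → n < N → + 0 ℤ∣.∣ (X *ˢ (Y +ˢ -ˢ Y′)) n
  zero-below n n<N = ℤ∣.divides (+ 0) (trans
    (at (solve 3 (λ x y y′ → x :* (y :+ :- y′) := x :* y :+ :- (x :* y′)) S.refl X Y Y′) n)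
    (trans (difference n) (trans (cong (Z._+ Z.- (X *ˢ Y′) n) (below p n n<N)) (ℤₚ.+-inverseʳ ((X *ˢ Y′) n)))))

*ˢ-cancelˡ : ∀ X {Y Y′} → X 0 ≡ + 1 → X *ˢ Y ≈ X *ˢ Y′ → Y ≈ Y′
*ˢ-cancelˡ X X0≡1 p = ≈[]⇒≈ λ N → *ˢ-cancelˡ[] X X0≡1 (≈⇒≈[] p)

mono : ℤ → ℕ → Series
mono c zero = const c
mono c (suc e) zero = + 0
mono c (suc e) (suc n) = mono c e n

private
  scale-mono : ∀ c d e n → c Z.* mono d e n ≡ mono (c Z.* d) e n
  scale-mono c d zero zero = refl
  scale-mono c d zero (suc n) = ℤₚ.*-zeroʳ c
  scale-mono c d (suc e) zero = ℤₚ.*-zeroʳ c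
  scale-mono c d (suc e) (suc n) = scale-mono c d e n

mono-*ˢ : ∀ c d e g → mono c e *ˢ mono d g ≈ mono (c Z.* d) (e + g)
mono-*ˢ c d zero g = mk λ n → trans (const-*ˢ-at c (mono d g) n) (scale-mono c d g n)
mono-*ˢ c d (suc e) g = mk λ { zero → refl ; (suc n) → trans (ℤₚ.+-identityˡ _) (at (mono-*ˢ c d e g) n) }

mono-cong : ∀ {c d e g} → c ≡ d → e ≡ g → mono c e ≈ mono d g
mono-cong refl refl = S.refl

mono-neg : ∀ e → mono -[1+ 0 ] e ≈ -ˢ mono (+ 1) e
mono-neg e = mk λ n → trans (go e n) (sym (-ˢ-at (mono (+ 1) e) n))
  where
  go : ∀ e n → mono -[1+ 0 ] e n ≡ Z.- mono (+ 1) e n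
  go zero zero = refl
  go zero (suc n) = refl
  go (suc e) zero = refl
  go (suc e) (suc n) = go e n

mono-≈0 : ∀ {N} c e → N ≤ e → mono c e ≈[ N ] 0ˢ
mono-≈0 c e N≤e = mk λ n n<N → trans (go e n (ℕₚ.≤-trans n<N N≤e)) (sym (0ˢ-at n))
  where
  go : ∀ e n → n < e → mono c e n ≡ + 0
  go (suc e) zero _ = refl
  go (suc e) (suc n) (s≤s n<e) = go e n n<e

prod : (ℕ → Series) → ℕ → Series
prod f zero = 1ˢ
prod f (suc n) = prod f n *ˢ f n

-- Factors of index at least N do not matter modulo q^N, which is why `∏` may read the coefficient
-- of q^n off the first n + 1 factors.
Convergent : (ℕ → Series) → Set
Convergent f = ∀ k → f k ≈[ k ] 1ˢ

∏ : (ℕ → Series) → Series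
∏ f n = prod f (suc n) n

prod-stable : ∀ {f} → Convergent f → ∀ {M N} → N ≤ M → prod f M ≈[ N ] prod f N
prod-stable {f} conv {M} {N} N≤M = subst (λ m → prod f m ≈[ N ] prod f N) (ℕₚ.m∸n+n≡m N≤M) (go (M ∸ N))
  where
  go : ∀ d → prod f (d + N) ≈[ N ] prod f N
  go zero = ≈[]-refl
  go (suc d) = ≈[]-trans (*ˢ-cong[] (go d) (≈[]-≤ (ℕₚ.m≤n+m N d) (conv (d + N)))) (≈⇒≈[] (S.*-identityʳ _))

prod≈∏ : ∀ {f} → Convergent f → ∀ {M N} → N ≤ M → prod f M ≈[ N ] ∏ f
prod≈∏ conv N≤M = mk λ n n<N → below (prod-stable conv (ℕₚ.≤-trans n<N N≤M)) n ℕₚ.≤-refl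

prod-cong : ∀ {f g} → (∀ k → f k ≈ g k) → ∀ n → prod f n ≈ prod g n
prod-cong p zero = S.refl
prod-cong p (suc n) = S.*-cong (prod-cong p n) (p n)

prod-*ˢ : ∀ f g n → prod (λ k → f k *ˢ g k) n ≈ prod f n *ˢ prod g n
prod-*ˢ f g zero = S.sym (S.*-identityˡ 1ˢ)
prod-*ˢ f g (suc n) = S.trans (S.*-congʳ (prod-*ˢ f g n))
  (solve 4 (λ p q x y → p :* q :* (x :* y) := p :* x :* (q :* y)) S.refl _ _ (f n) (g n))
  where open SeriesSolver

factor : ℤ → ℕ → ℕ → ℕ → Series
factor ε c r k = 1ˢ +ˢ mono ε (r + k * c)

factor-convergent : ∀ ε c r .{{_ : NonZero c}} → Convergent (factor ε c r)
factor-convergent ε c r k = ≈[]-trans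
  (+ˢ-cong[] ≈[]-refl (mono-≈0 ε _ (ℕₚ.≤-trans (ℕₚ.m≤m*n k c) (ℕₚ.m≤n+m (k * c) r))))
  (≈⇒≈[] (S.+-identityʳ 1ˢ))

-- The Pochhammer product (-ε q^r ; q^c)_∞.
Π : ℤ → ℕ → ℕ → Series
Π ε c r = ∏ (factor ε c r)

Π≈prod : ∀ ε c r .{{_ : NonZero c}} {M N} → N ≤ M → prod (factor ε c r) M ≈[ N ] Π ε c r
Π≈prod ε c r N≤M = prod≈∏ (factor-convergent ε c r) N≤M

Π-at-0 : ∀ ε c r .{{_ : NonZero r}} → Π ε c r 0 ≡ + 1
Π-at-0 ε c (suc r) = trans (ℤₚ.*-identityˡ _) (+ˢ-at 1ˢ (mono ε (suc r + 0)) 0)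

-- A sum over the diagonal k + l = m. Carrying both indices avoids the subtraction m - k.
anti : ℕ → (ℕ → ℕ → Series) → Series
anti zero h = h 0 0
anti (suc m) h = h 0 (suc m) +ˢ anti m (λ k → h (suc k))

anti-cong[] : ∀ {N} m {h h′} → (∀ k l → k + l ≡ m → h k l ≈[ N ] h′ k l) → anti m h ≈[ N ] anti m h′
anti-cong[] zero p = p 0 0 refl
anti-cong[] (suc m) p = +ˢ-cong[] (p 0 (suc m) refl) (anti-cong[] m (λ k l eq → p (suc k) l (cong suc eq)))

anti-cong : ∀ m {h h′} → (∀ k l → k + l ≡ m → h k l ≈ h′ k l) → anti m h ≈ anti m h′
anti-cong m p = ≈[]⇒≈ λ N → anti-cong[] m (λ k l eq → ≈⇒≈[] (p k l eq))

anti-suc : ∀ m h → anti (suc m) h ≈ anti m (λ k l → h k (suc l)) +ˢ h (suc m) 0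
anti-suc zero h = S.refl
anti-suc (suc m) h = S.trans (S.+-congˡ (anti-suc m (λ k → h (suc k)))) (S.sym (S.+-assoc _ _ _))

anti-+ˢ : ∀ m f g → anti m (λ k l → f k l +ˢ g k l) ≈ anti m f +ˢ anti m g
anti-+ˢ zero f g = S.refl
anti-+ˢ (suc m) f g = S.trans (S.+-congˡ (anti-+ˢ m (λ k → f (suc k)) (λ k → g (suc k))))
  (solve 4 (λ a b c d → a :+ b :+ (c :+ d) := a :+ c :+ (b :+ d)) S.refl (f 0 (suc m)) (g 0 (suc m)) _ _)
  where open SeriesSolver

anti-*ˢ : ∀ m X h → anti m (λ k l → X *ˢ h k l) ≈ X *ˢ anti m h
anti-*ˢ zero X h = S.refl
anti-*ˢ (suc m) X h = S.trans (S.+-congˡ (anti-*ˢ m X (λ k → h (suc k)))) (S.sym (S.distribˡ X _ _))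

-- Regrouping by parents in Pascal's triangle: (k , l) sends `a k l` to (k + 1 , l) and `b k l` to
-- (k , l + 1). Interior entries of the next diagonal have two parents, the two end entries only
-- one.
anti-pascal : ∀ m w a b → (∀ l → w 0 (suc l) ≈ b 0 l) → (∀ k → w (suc k) 0 ≈ a k 0) →
  (∀ k l → w (suc k) (suc l) ≈ a k (suc l) +ˢ b (suc k) l) →
  anti (suc m) w ≈ anti m (λ k l → a k l +ˢ b k l)
anti-pascal m w a b left right inner = begin
  anti (suc m) w ≈⟨ anti-cong (suc m) split ⟩
  anti (suc m) (λ k l → a⁺ k l +ˢ b⁺ k l) ≈⟨ anti-+ˢ (suc m) a⁺ b⁺ ⟩
  0ˢ +ˢ anti m a +ˢ anti (suc m) b⁺ ≈⟨ S.+-cong (S.+-identityˡ _) (S.trans (anti-suc m b⁺) (S.+-identityʳ _)) ⟩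
  anti m a +ˢ anti m b ≈⟨ anti-+ˢ m a b ⟨
  anti m (λ k l → a k l +ˢ b k l) ∎
  where
  open ≈-Reasoning
  a⁺ b⁺ : ℕ → ℕ → Series
  a⁺ zero l = 0ˢ
  a⁺ (suc k) l = a k l
  b⁺ k zero = 0ˢ
  b⁺ k (suc l) = b k l

  split : ∀ k l → k + l ≡ suc m → w k l ≈ a⁺ k l +ˢ b⁺ k l
  split zero (suc l) _ = S.trans (left l) (S.sym (S.+-identityˡ _))
  split (suc k) zero _ = S.trans (right k) (S.sym (S.+-identityʳ _))
  split (suc k) (suc l) _ = inner k l

module Gauss (c : ℕ) where

  q : ℕ → Series
  q m = mono (+ 1) (m * c)

  q-+ : ∀ k l → q (k + l) ≈ q k *ˢ q l
  q-+ k l = S.sym (S.trans (mono-*ˢ (+ 1) (+ 1) (k * c) (l * c)) (mono-cong refl (sym (ℕₚ.*-distribʳ-+ c k l))))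

  -- The Gaussian binomial coefficient of k + l over k at base q^c, indexed to fit the diagonals of
  -- `anti`. The recursion is one of the two q-Pascal rules.
  binomial : ℕ → ℕ → Series
  binomial zero l = 1ˢ
  binomial (suc k) zero = 1ˢ
  binomial (suc k) (suc l) = binomial k (suc l) +ˢ q (suc k) *ˢ binomial (suc k) l

  binomial-zeroʳ : ∀ k → binomial k 0 ≈ 1ˢ
  binomial-zeroʳ zero = S.refl
  binomial-zeroʳ (suc k) = S.refl

  private
    1-q : ℕ → Series
    1-q m = 1ˢ +ˢ -ˢ q m

  -- Proved by mutual induction: at (k , l) the two together give (1 - q^(l+1)) [k , l+1] = (1 -
  -- q^(k+1)) [k+1 , l] at base q^c, which is the exchange that the q-Pascal rule calls for in
  -- either inductive step.
  absorbˡ : ∀ k l → 1-q (suc l) *ˢ binomial k (suc l) ≈ 1-q (suc (k + l)) *ˢ binomial k l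
  absorbʳ : ∀ k l → 1-q (suc k) *ˢ binomial (suc k) l ≈ 1-q (suc (k + l)) *ˢ binomial k l

  absorbˡ zero l = S.refl
  absorbˡ (suc k) l = begin
    1-q (suc l) *ˢ (binomial k (suc l) +ˢ q (suc k) *ˢ binomial (suc k) l)
      ≈⟨ solve 4 (λ u v x y → (con (+ 1) :+ :- u) :* (x :+ v :* y)
           := (con (+ 1) :+ :- u) :* x :+ v :* (con (+ 1) :+ :- u) :* y) S.refl (q (suc l)) (q (suc k)) _ _ ⟩
    1-q (suc l) *ˢ binomial k (suc l) +ˢ q (suc k) *ˢ 1-q (suc l) *ˢ binomial (suc k) l
      ≈⟨ S.+-congʳ (S.trans (absorbˡ k l) (S.sym (absorbʳ k l))) ⟩
    1-q (suc k) *ˢ binomial (suc k) l +ˢ q (suc k) *ˢ 1-q (suc l) *ˢ binomial (suc k) l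
      ≈⟨ solve 3 (λ u v y → (con (+ 1) :+ :- v) :* y :+ v :* (con (+ 1) :+ :- u) :* y
           := (con (+ 1) :+ :- (v :* u)) :* y) S.refl (q (suc l)) (q (suc k)) _ ⟩
    (1ˢ +ˢ -ˢ (q (suc k) *ˢ q (suc l))) *ˢ binomial (suc k) l
      ≈⟨ S.*-congʳ (S.+-congˡ (S.-‿cong (S.trans (S.sym (q-+ (suc k) (suc l))) (mono-cong refl (cong (_* c) (ℕₚ.+-suc (suc k) l)))))) ⟩
    1-q (suc (suc k + l)) *ˢ binomial (suc k) l ∎
    where
    open ≈-Reasoning
    open SeriesSolver

  absorbʳ k zero = S.*-cong (S.reflexive (cong (λ m → 1-q (suc m)) (sym (ℕₚ.+-identityʳ k)))) (S.sym (binomial-zeroʳ k))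
  absorbʳ k (suc l) = begin
    1-q (suc k) *ˢ (binomial k (suc l) +ˢ q (suc k) *ˢ binomial (suc k) l)
      ≈⟨ solve 3 (λ v x y → (con (+ 1) :+ :- v) :* (x :+ v :* y)
           := (con (+ 1) :+ :- v) :* x :+ v :* ((con (+ 1) :+ :- v) :* y)) S.refl (q (suc k)) _ _ ⟩
    1-q (suc k) *ˢ binomial k (suc l) +ˢ q (suc k) *ˢ (1-q (suc k) *ˢ binomial (suc k) l)
      ≈⟨ S.+-congˡ (S.*-congˡ (S.trans (absorbʳ k l) (S.sym (absorbˡ k l)))) ⟩
    1-q (suc k) *ˢ binomial k (suc l) +ˢ q (suc k) *ˢ (1-q (suc l) *ˢ binomial k (suc l))
      ≈⟨ solve 3 (λ u v y → (con (+ 1) :+ :- v) :* y :+ v :* ((con (+ 1) :+ :- u) :* y)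
           := (con (+ 1) :+ :- (v :* u)) :* y) S.refl (q (suc l)) (q (suc k)) _ ⟩
    (1ˢ +ˢ -ˢ (q (suc k) *ˢ q (suc l))) *ˢ binomial k (suc l)
      ≈⟨ S.*-congʳ (S.+-congˡ (S.-‿cong (S.sym (q-+ (suc k) (suc l))))) ⟩
    1-q (suc (k + suc l)) *ˢ binomial k (suc l) ∎
    where
    open ≈-Reasoning
    open SeriesSolver

  -- The second q-Pascal rule. Its difference from the first is the difference of the two products
  -- that the absorption relations identify.
  binomial-sucʳ : ∀ k l → binomial (suc k) (suc l) ≈ q (suc l) *ˢ binomial k (suc l) +ˢ binomial (suc k) l
  binomial-sucʳ k l = begin
    binomial k (suc l) +ˢ q (suc k) *ˢ binomial (suc k) l
      ≈⟨ solve 4 (λ u v x y → x :+ v :* y := u :* x :+ v :* y :+ (con (+ 1) :+ :- u) :* x) S.refl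
           (q (suc l)) (q (suc k)) _ _ ⟩
    q (suc l) *ˢ binomial k (suc l) +ˢ q (suc k) *ˢ binomial (suc k) l +ˢ 1-q (suc l) *ˢ binomial k (suc l)
      ≈⟨ S.+-congˡ (S.trans (absorbˡ k l) (S.sym (absorbʳ k l))) ⟩
    q (suc l) *ˢ binomial k (suc l) +ˢ q (suc k) *ˢ binomial (suc k) l +ˢ 1-q (suc k) *ˢ binomial (suc k) l
      ≈⟨ solve 4 (λ u v x y → u :* x :+ v :* y :+ (con (+ 1) :+ :- v) :* y := u :* x :+ y) S.refl
           (q (suc l)) (q (suc k)) _ _ ⟩
    q (suc l) *ˢ binomial k (suc l) +ˢ binomial (suc k) l ∎
    where
    open ≈-Reasoning
    open SeriesSolver

  factorial : ℕ → Series
  factorial = prod (factor -[1+ 0 ] c c)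

  factorial-suc : ∀ k → factorial (suc k) ≈ factorial k *ˢ 1-q (suc k)
  factorial-suc k = S.*-congˡ (S.+-congˡ (mono-neg (suc k * c)))

  binomial-factorial : ∀ k l → binomial k l *ˢ (factorial k *ˢ factorial l) ≈ factorial (k + l)
  binomial-factorial k zero = S.trans (S.*-cong (binomial-zeroʳ k) (S.*-identityʳ _))
    (S.trans (S.*-identityˡ _) (S.reflexive (cong factorial (sym (ℕₚ.+-identityʳ k)))))
  binomial-factorial k (suc l) = begin
    binomial k (suc l) *ˢ (factorial k *ˢ factorial (suc l))
      ≈⟨ S.*-congˡ (S.*-congˡ (factorial-suc l)) ⟩
    binomial k (suc l) *ˢ (factorial k *ˢ (factorial l *ˢ 1-q (suc l)))
      ≈⟨ solve 4 (λ x a b u → x :* (a :* (b :* u)) := (u :* x) :* (a :* b)) S.refl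
           (binomial k (suc l)) (factorial k) (factorial l) (1-q (suc l)) ⟩
    1-q (suc l) *ˢ binomial k (suc l) *ˢ (factorial k *ˢ factorial l)
      ≈⟨ S.*-congʳ (absorbˡ k l) ⟩
    1-q (suc (k + l)) *ˢ binomial k l *ˢ (factorial k *ˢ factorial l)
      ≈⟨ solve 4 (λ u x a b → u :* x :* (a :* b) := x :* (a :* b) :* u) S.refl
           (1-q (suc (k + l))) (binomial k l) (factorial k) (factorial l) ⟩
    binomial k l *ˢ (factorial k *ˢ factorial l) *ˢ 1-q (suc (k + l))
      ≈⟨ S.*-congʳ (binomial-factorial k l) ⟩
    factorial (k + l) *ˢ 1-q (suc (k + l))
      ≈⟨ factorial-suc (k + l) ⟨
    factorial (suc (k + l))
      ≈⟨ S.reflexive (cong factorial (sym (ℕₚ.+-suc k l))) ⟩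
    factorial (k + suc l) ∎
    where
    open ≈-Reasoning
    open SeriesSolver

  -- Read from right to left, this and its companion advance a diagonal by one, each by one of the
  -- q-Pascal rules. In the finite triple product the companion takes in a factor built on `a`, this
  -- one a factor built on `b`.
  anti-binomialˡ : ∀ m (h : ℕ → ℕ → Series) → anti (suc m) (λ k l → binomial k l *ˢ h k l) ≈
    anti m (λ k l → binomial k l *ˢ (h (suc k) l +ˢ q k *ˢ h k (suc l)))
  anti-binomialˡ m h = S.trans
    (anti-pascal m (λ k l → binomial k l *ˢ h k l) (λ k l → binomial k l *ˢ h (suc k) l) (λ k l → q k *ˢ binomial k l *ˢ h k (suc l))
      (λ l → S.*-congʳ (S.sym (S.*-identityʳ 1ˢ)))
      (λ k → S.*-congʳ (S.sym (binomial-zeroʳ k)))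
      (λ k l → S.distribʳ (h (suc k) (suc l)) _ _))
    (anti-cong m λ k l _ → solve 4 (λ g u x y → g :* x :+ u :* g :* y := g :* (x :+ u :* y)) S.refl
      (binomial k l) (q k) (h (suc k) l) (h k (suc l)))
    where open SeriesSolver

  anti-binomialʳ : ∀ m (h : ℕ → ℕ → Series) → anti (suc m) (λ k l → binomial k l *ˢ h k l) ≈
    anti m (λ k l → binomial k l *ˢ (q l *ˢ h (suc k) l +ˢ h k (suc l)))
  anti-binomialʳ m h = S.trans
    (anti-pascal m (λ k l → binomial k l *ˢ h k l) (λ k l → q l *ˢ binomial k l *ˢ h (suc k) l) (λ k l → binomial k l *ˢ h k (suc l))
      (λ l → S.refl)
      (λ k → S.*-congʳ (S.trans (S.sym (binomial-zeroʳ k)) (S.sym (S.*-identityˡ _))))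
      (λ k l → S.trans (S.*-congʳ (binomial-sucʳ k l)) (S.distribʳ (h (suc k) (suc l)) _ _)))
    (anti-cong m λ k l _ → solve 4 (λ g u x y → u :* g :* x :+ g :* y := g :* (u :* x :+ y)) S.refl
      (binomial k l) (q l) (h (suc k) l) (h k (suc l)))
    where open SeriesSolver

  module _ .{{_ : NonZero c}} where

    -- In `binomial-factorial`, the factorials of k, l and k + l all agree with f modulo q^K, so f ·
    -- (f · binomial) ≡ f, and one f cancels.
    binomial-limit : ∀ K k l → K ≤ k → K ≤ l → Π -[1+ 0 ] c c *ˢ binomial k l ≈[ K ] 1ˢ
    binomial-limit K k l K≤k K≤l = *ˢ-cancelˡ[] f f0≡1
      (≈[]-trans (≈⇒≈[] (solve 2 (λ f g → f :* (f :* g) := g :* (f :* f)) S.refl f (binomial k l)))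
      (≈[]-trans (*ˢ-cong[] ≈[]-refl (*ˢ-cong[] (≈[]-sym (f≈ K≤k)) (≈[]-sym (f≈ K≤l))))
      (≈[]-trans (≈⇒≈[] (binomial-factorial k l))
      (≈[]-trans (f≈ (ℕₚ.≤-trans K≤k (ℕₚ.m≤m+n k l))) (≈⇒≈[] (S.sym (S.*-identityʳ f)))))))
      where
      open SeriesSolver
      f = Π -[1+ 0 ] c c
      f≈ : ∀ {M} → K ≤ M → factorial M ≈[ K ] f
      f≈ = Π≈prod -[1+ 0 ] c c
      f0≡1 : f 0 ≡ + 1
      f0≡1 = Π-at-0 -[1+ 0 ] c c

-- The Jacobi triple product

n*2≡n+n : ∀ n → n * 2 ≡ n + n
n*2≡n+n n = trans (ℕₚ.*-comm n 2) (cong (_+_ n) (ℕₚ.+-identityʳ n))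

triangular : ℕ → ℕ
triangular zero = 0
triangular (suc n) = suc n + triangular n

-- j (j + 1) / 2 for every integer j; at j = -(n + 1) this is n (n + 1) / 2.
tri : ℤ → ℕ
tri (+ n) = triangular n
tri -[1+ n ] = triangular n

-- With j = k - n this is tri (j + 1) = tri j + (j + 1), the increment being split over both sides
-- to stay within ℕ. The next lemma treats tri (-j - 1) = tri (-j) + j in the same way.
tri-⊖-sucˡ : ∀ k n → tri (suc k ⊖ n) + n ≡ tri (k ⊖ n) + suc k
tri-⊖-sucˡ k zero = trans (ℕₚ.+-identityʳ _) (ℕₚ.+-comm (suc k) (triangular k))
tri-⊖-sucˡ zero (suc zero) = refl
tri-⊖-sucˡ zero (suc (suc n)) = solve 2 (λ t n → t :+ (con 2 :+ n) := con 1 :+ n :+ t :+ con 1) refl (triangular n) n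
  where open +-*-Solver
tri-⊖-sucˡ (suc k) (suc n) = begin
  tri (suc (suc k) ⊖ suc n) + suc n ≡⟨ cong (λ j → tri j + suc n) (ℤₚ.[1+m]⊖[1+n]≡m⊖n (suc k) n) ⟩
  tri (suc k ⊖ n) + suc n ≡⟨ ℕₚ.+-suc _ n ⟩
  suc (tri (suc k ⊖ n) + n) ≡⟨ cong suc (tri-⊖-sucˡ k n) ⟩
  suc (tri (k ⊖ n) + suc k) ≡⟨ ℕₚ.+-suc _ (suc k) ⟨
  tri (k ⊖ n) + suc (suc k) ≡⟨ cong (λ j → tri j + suc (suc k)) (ℤₚ.[1+m]⊖[1+n]≡m⊖n k n) ⟨
  tri (suc k ⊖ suc n) + suc (suc k) ∎
  where open ≡-Reasoning

tri-⊖-sucʳ : ∀ k n → tri (n ⊖ suc k) + n ≡ tri (n ⊖ k) + k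
tri-⊖-sucʳ zero zero = refl
tri-⊖-sucʳ (suc k) zero = trans (ℕₚ.+-identityʳ _) (ℕₚ.+-comm (suc k) (triangular k))
tri-⊖-sucʳ zero (suc n) = trans (cong (λ j → tri j + suc n) (ℤₚ.[1+m]⊖[1+n]≡m⊖n n 0))
  (solve 2 (λ t n → t :+ (con 1 :+ n) := con 1 :+ n :+ t :+ con 0) refl (triangular n) n)
  where open +-*-Solver
tri-⊖-sucʳ (suc k) (suc n) = begin
  tri (suc n ⊖ suc (suc k)) + suc n ≡⟨ cong (λ j → tri j + suc n) (ℤₚ.[1+m]⊖[1+n]≡m⊖n n (suc k)) ⟩
  tri (n ⊖ suc k) + suc n ≡⟨ ℕₚ.+-suc _ n ⟩
  suc (tri (n ⊖ suc k) + n) ≡⟨ cong suc (tri-⊖-sucʳ k n) ⟩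
  suc (tri (n ⊖ k) + k) ≡⟨ ℕₚ.+-suc _ k ⟨
  tri (n ⊖ k) + suc k ≡⟨ cong (λ j → tri j + suc k) (ℤₚ.[1+m]⊖[1+n]≡m⊖n n k) ⟨
  tri (suc n ⊖ suc k) + suc k ∎
  where open ≡-Reasoning

exponent : ℕ → ℕ → ℤ → ℕ
exponent a b j = a * tri j + b * tri (Z.- j)

exponent-⊖-suc : ∀ a b k n → exponent a b (suc k ⊖ n) + n * (a + b) ≡ exponent a b (k ⊖ n) + a + k * (a + b)
exponent-⊖-suc a b k n = begin
  a * s + b * tri (Z.- (suc k ⊖ n)) + n * (a + b)
    ≡⟨ cong (λ j → a * s + b * tri j + n * (a + b)) (sym (ℤₚ.⊖-swap n (suc k))) ⟩
  a * s + b * tri (n ⊖ suc k) + n * (a + b)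
    ≡⟨ solve 5 (λ a b s t n → a :* s :+ b :* t :+ n :* (a :+ b) := a :* (s :+ n) :+ b :* (t :+ n)) refl a b s (tri (n ⊖ suc k)) n ⟩
  a * (s + n) + b * (tri (n ⊖ suc k) + n)
    ≡⟨ cong₂ (λ x y → a * x + b * y) (tri-⊖-sucˡ k n) (tri-⊖-sucʳ k n) ⟩
  a * (tri (k ⊖ n) + suc k) + b * (tri (n ⊖ k) + k)
    ≡⟨ solve 5 (λ a b s t k → a :* (s :+ (con 1 :+ k)) :+ b :* (t :+ k) := a :* s :+ b :* t :+ a :+ k :* (a :+ b)) refl
         a b (tri (k ⊖ n)) (tri (n ⊖ k)) k ⟩
  a * tri (k ⊖ n) + b * tri (n ⊖ k) + a + k * (a + b)
    ≡⟨ cong (λ j → a * tri (k ⊖ n) + b * tri j + a + k * (a + b)) (ℤₚ.⊖-swap n k) ⟩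
  exponent a b (k ⊖ n) + a + k * (a + b) ∎
  where
  open ≡-Reasoning
  open +-*-Solver
  s = tri (suc k ⊖ n)

n≤triangular : ∀ n → n ≤ triangular n
n≤triangular zero = z≤n
n≤triangular (suc n) = ℕₚ.m≤m+n (suc n) (triangular n)

-- The case a = 0 occurs in `theta (+ 1) 0 3`, so the bound rests on b j (j - 1) / 2. That
-- expression vanishes at j = 1, whence the added 1.
∣j∣≤1+exponent : ∀ a b .{{_ : NonZero b}} j → ∣ j ∣ ≤ suc (exponent a b j)
∣j∣≤1+exponent a b j = ℕₚ.≤-trans (∣j∣≤ j)
  (s≤s (ℕₚ.≤-trans (ℕₚ.m≤n*m (tri (Z.- j)) b) (ℕₚ.m≤n+m (b * tri (Z.- j)) (a * tri j))))
  where
  ∣j∣≤ : ∀ j → ∣ j ∣ ≤ suc (tri (Z.- j))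
  ∣j∣≤ (+ zero) = z≤n
  ∣j∣≤ (+ suc n) = s≤s (n≤triangular n)
  ∣j∣≤ -[1+ n ] = ℕₚ.m≤n⇒m≤1+n (n≤triangular (suc n))

-- As ε² = 1, only the parity of the power counts, so raising j by one multiplies by ε even where ∣
-- j ∣ decreases.
sign-⊖-suc : ∀ ε → ε Z.* ε ≡ + 1 → ∀ k n → ε Z.* ε Z.^ ∣ k ⊖ n ∣ ≡ ε Z.^ ∣ suc k ⊖ n ∣
sign-⊖-suc ε ε²≡1 k zero = refl
sign-⊖-suc ε ε²≡1 zero (suc n) = trans (sym (ℤₚ.*-assoc ε ε (ε Z.^ n)))
  (trans (cong (Z._* ε Z.^ n) ε²≡1) (trans (ℤₚ.*-identityˡ (ε Z.^ n)) (cong (ε Z.^_) (sym (lemma n)))))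
  where
  lemma : ∀ n → ∣ 1 ⊖ suc n ∣ ≡ n
  lemma zero = refl
  lemma (suc n) = refl
sign-⊖-suc ε ε²≡1 (suc k) (suc n) = trans (cong (λ j → ε Z.* ε Z.^ ∣ j ∣) (ℤₚ.[1+m]⊖[1+n]≡m⊖n k n))
  (trans (sign-⊖-suc ε ε²≡1 k n) (cong (λ j → ε Z.^ ∣ j ∣) (sym (ℤₚ.[1+m]⊖[1+n]≡m⊖n (suc k) n))))

term : ℤ → ℕ → ℕ → ℤ → Series
term ε a b j = mono (ε Z.^ ∣ j ∣) (exponent a b j)

range : ℕ → List ℤ
range zero = + 0 ∷ []
range (suc n) = + suc n ∷ -[1+ n ] ∷ range n

sumOver : {A : Set} → List A → (A → Series) → Series
sumOver [] f = 0ˢ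
sumOver (x ∷ xs) f = f x +ˢ sumOver xs f

-- The substitution j = k - n carries the diagonal k + l = 2 n to the interval from -n to n.
anti-range : ∀ (f : ℤ → Series) n → anti (n * 2) (λ k _ → f (k ⊖ n)) ≈ sumOver (range n) f
anti-range f zero = S.sym (S.+-identityʳ _)
anti-range f (suc n) = begin
  f -[1+ n ] +ˢ anti (suc (n * 2)) (λ k _ → f (suc k ⊖ suc n))
    ≈⟨ S.+-congˡ (anti-cong (suc (n * 2)) (λ k _ _ → S.reflexive (cong f (ℤₚ.[1+m]⊖[1+n]≡m⊖n k n)))) ⟩
  f -[1+ n ] +ˢ anti (suc (n * 2)) (λ k _ → f (k ⊖ n))
    ≈⟨ S.+-congˡ (S.trans (anti-suc (n * 2) (λ k _ → f (k ⊖ n))) (S.+-cong (anti-range f n) (S.reflexive (cong f (last n))))) ⟩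
  f -[1+ n ] +ˢ (sumOver (range n) f +ˢ f (+ suc n))
    ≈⟨ solve 3 (λ x y z → x :+ (y :+ z) := z :+ (x :+ y)) S.refl (f -[1+ n ]) (sumOver (range n) f) (f (+ suc n)) ⟩
  f (+ suc n) +ˢ (f -[1+ n ] +ˢ sumOver (range n) f) ∎
  where
  open ≈-Reasoning
  open SeriesSolver
  last : ∀ n → suc (n * 2) ⊖ n ≡ + suc n
  last n = trans (ℤₚ.⊖-≥ (ℕₚ.m≤n⇒m≤1+n (ℕₚ.m≤m*n n 2))) (cong +_ (trans
    (cong (λ m → suc m ∸ n) (n*2≡n+n n))
    (trans (cong (_∸ n) (sym (ℕₚ.+-suc n n))) (ℕₚ.m+n∸m≡n n (suc n)))))

partialTheta : ℤ → ℕ → ℕ → ℕ → Series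
partialTheta ε a b M = sumOver (range M) (term ε a b)

-- For nonzero b, exponent n forces ∣ j ∣ ≤ n + 1, so this partial sum already has the final
-- coefficient of q^n.
theta : ℤ → ℕ → ℕ → Series
theta ε a b n = partialTheta ε a b (suc n) n

term-≈0 : ∀ ε a b .{{_ : NonZero b}} {N} j → N < ∣ j ∣ → term ε a b j ≈[ N ] 0ˢ
term-≈0 ε a b j N<∣j∣ = mono-≈0 _ (exponent a b j) (ℕₚ.≤-pred (ℕₚ.≤-trans N<∣j∣ (∣j∣≤1+exponent a b j)))

partialTheta-stable : ∀ ε a b .{{_ : NonZero b}} {M N} → N ≤ M → partialTheta ε a b M ≈[ N ] partialTheta ε a b N
partialTheta-stable ε a b {M} {N} N≤M =
  subst (λ m → partialTheta ε a b m ≈[ N ] partialTheta ε a b N) (ℕₚ.m∸n+n≡m N≤M) (go (M ∸ N))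
  where
  go : ∀ d → partialTheta ε a b (d + N) ≈[ N ] partialTheta ε a b N
  go zero = ≈[]-refl
  go (suc d) = ≈[]-trans
    (+ˢ-cong[] (term-≈0 ε a b (+ suc (d + N)) (s≤s (ℕₚ.m≤n+m N d)))
      (≈[]-trans (+ˢ-cong[] (term-≈0 ε a b -[1+ d + N ] (s≤s (ℕₚ.m≤n+m N d))) (go d)) (≈⇒≈[] (S.+-identityˡ _))))
    (≈⇒≈[] (S.+-identityˡ _))

partialTheta≈theta : ∀ ε a b .{{_ : NonZero b}} {M N} → N ≤ M → partialTheta ε a b M ≈[ N ] theta ε a b
partialTheta≈theta ε a b N≤M = mk λ n n<N →
  below (partialTheta-stable ε a b (ℕₚ.≤-trans n<N N≤M)) n ℕₚ.≤-refl

module JacobiTriple (ε : ℤ) (ε²≡1 : ε Z.* ε ≡ + 1) (a b : ℕ) where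

  c : ℕ
  c = a + b

  open Gauss c

  -- With j = k - n and c = a + b, the exponents of neighbouring theta terms differ by a + j c, so
  -- the excess is q^(s c) with s = p - j. The hypothesis states this without subtraction; in
  -- `term-sucʳ` the excess has s = p + 1 + j.
  term-sucˡ : ∀ p s k n → p + n ≡ s + k →
    mono ε (a + p * c) *ˢ term ε a b (k ⊖ n) ≈ q s *ˢ term ε a b (suc k ⊖ n)
  term-sucˡ p s k n eq = S.trans (mono-*ˢ ε (ε Z.^ ∣ k ⊖ n ∣) (a + p * c) (exponent a b (k ⊖ n))) (S.trans
    (mono-cong (trans (sign-⊖-suc ε ε²≡1 k n) (sym (ℤₚ.*-identityˡ _))) (ℕₚ.+-cancelʳ-≡ (n * c) _ _ exps))
    (S.sym (mono-*ˢ (+ 1) (ε Z.^ ∣ suc k ⊖ n ∣) (s * c) (exponent a b (suc k ⊖ n)))))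
    where
    open ≡-Reasoning
    open +-*-Solver
    exps : a + p * c + exponent a b (k ⊖ n) + n * c ≡ s * c + exponent a b (suc k ⊖ n) + n * c
    exps = begin
      a + p * c + exponent a b (k ⊖ n) + n * c
        ≡⟨ solve 5 (λ a p c e n → a :+ p :* c :+ e :+ n :* c := (p :+ n) :* c :+ (e :+ a)) refl a p c (exponent a b (k ⊖ n)) n ⟩
      (p + n) * c + (exponent a b (k ⊖ n) + a) ≡⟨ cong (λ x → x * c + (exponent a b (k ⊖ n) + a)) eq ⟩
      (s + k) * c + (exponent a b (k ⊖ n) + a)
        ≡⟨ solve 5 (λ a s c e k → (s :+ k) :* c :+ (e :+ a) := s :* c :+ (e :+ a :+ k :* c)) refl a s c (exponent a b (k ⊖ n)) k ⟩
      s * c + (exponent a b (k ⊖ n) + a + k * c) ≡⟨ cong (_+_ (s * c)) (exponent-⊖-suc a b k n) ⟨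
      s * c + (exponent a b (suc k ⊖ n) + n * c) ≡⟨ ℕₚ.+-assoc (s * c) _ _ ⟨
      s * c + exponent a b (suc k ⊖ n) + n * c ∎

  term-sucʳ : ∀ p s k n → s + n ≡ suc p + k →
    mono ε (b + p * c) *ˢ term ε a b (suc k ⊖ n) ≈ q s *ˢ term ε a b (k ⊖ n)
  term-sucʳ p s k n eq = S.trans (mono-*ˢ ε (ε Z.^ ∣ suc k ⊖ n ∣) (b + p * c) (exponent a b (suc k ⊖ n))) (S.trans
    (mono-cong signs (ℕₚ.+-cancelʳ-≡ (n * c) _ _ exps))
    (S.sym (mono-*ˢ (+ 1) (ε Z.^ ∣ k ⊖ n ∣) (s * c) (exponent a b (k ⊖ n)))))
    where
    signs : ε Z.* ε Z.^ ∣ suc k ⊖ n ∣ ≡ + 1 Z.* ε Z.^ ∣ k ⊖ n ∣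
    signs = trans (cong (ε Z.*_) (sym (sign-⊖-suc ε ε²≡1 k n)))
      (trans (sym (ℤₚ.*-assoc ε ε _)) (cong (Z._* ε Z.^ ∣ k ⊖ n ∣) ε²≡1))
    open ≡-Reasoning
    open +-*-Solver
    exps : b + p * c + exponent a b (suc k ⊖ n) + n * c ≡ s * c + exponent a b (k ⊖ n) + n * c
    exps = begin
      b + p * c + exponent a b (suc k ⊖ n) + n * c ≡⟨ ℕₚ.+-assoc (b + p * c) _ _ ⟩
      b + p * c + (exponent a b (suc k ⊖ n) + n * c) ≡⟨ cong (_+_ (b + p * c)) (exponent-⊖-suc a b k n) ⟩
      b + p * c + (exponent a b (k ⊖ n) + a + k * c)
        ≡⟨ solve 5 (λ a b p e k → b :+ p :* (a :+ b) :+ (e :+ a :+ k :* (a :+ b)) := (con 1 :+ p :+ k) :* (a :+ b) :+ e) refl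
             a b p (exponent a b (k ⊖ n)) k ⟩
      (suc p + k) * c + exponent a b (k ⊖ n) ≡⟨ cong (λ x → x * c + exponent a b (k ⊖ n)) eq ⟨
      (s + n) * c + exponent a b (k ⊖ n)
        ≡⟨ solve 4 (λ s n c e → (s :+ n) :* c :+ e := s :* c :+ e :+ n :* c) refl s n c (exponent a b (k ⊖ n)) ⟩
      s * c + exponent a b (k ⊖ n) + n * c ∎

  -- The finite form of the triple product, a q-binomial theorem centred at j = 0. Going from n to n
  -- + 1 moves the diagonal from 2 n to 2 n + 2 in two steps, one for each new factor; the centre
  -- moves from n to n + 1 in the second of them.
  finite : ∀ n → prod (factor ε c a) n *ˢ prod (factor ε c b) n ≈
    anti (n * 2) (λ k l → binomial k l *ˢ term ε a b (k ⊖ n))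
  finite zero = S.*-congˡ (S.sym (mono-cong refl (cong₂ _+_ (ℕₚ.*-zeroʳ a) (ℕₚ.*-zeroʳ b))))
  finite (suc n) = begin
    prod (factor ε c a) n *ˢ factor ε c a n *ˢ (prod (factor ε c b) n *ˢ factor ε c b n)
      ≈⟨ solve 4 (λ x y z w → x :* y :* (z :* w) := w :* (y :* (x :* z))) S.refl
           (prod (factor ε c a) n) (factor ε c a n) (prod (factor ε c b) n) (factor ε c b n) ⟩
    factor ε c b n *ˢ (factor ε c a n *ˢ (prod (factor ε c a) n *ˢ prod (factor ε c b) n))
      ≈⟨ S.*-congˡ (S.*-congˡ (finite n)) ⟩
    factor ε c b n *ˢ (factor ε c a n *ˢ anti (n * 2) (λ k l → binomial k l *ˢ term ε a b (k ⊖ n)))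
      ≈⟨ S.*-congˡ (S.trans (S.sym (anti-*ˢ (n * 2) (factor ε c a n) (λ k l → binomial k l *ˢ term ε a b (k ⊖ n)))) (anti-cong (n * 2) stepˡ)) ⟩
    factor ε c b n *ˢ anti (n * 2) (λ k l → binomial k l *ˢ (q l *ˢ term ε a b (suc k ⊖ n) +ˢ term ε a b (k ⊖ n)))
      ≈⟨ S.*-congˡ (S.sym (anti-binomialʳ (n * 2) (λ k _ → term ε a b (k ⊖ n)))) ⟩
    factor ε c b n *ˢ anti (suc (n * 2)) (λ k l → binomial k l *ˢ term ε a b (k ⊖ n))
      ≈⟨ S.trans (S.sym (anti-*ˢ (suc (n * 2)) (factor ε c b n) (λ k l → binomial k l *ˢ term ε a b (k ⊖ n)))) (anti-cong (suc (n * 2)) stepʳ) ⟩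
    anti (suc (n * 2)) (λ k l → binomial k l *ˢ (term ε a b (suc k ⊖ suc n) +ˢ q k *ˢ term ε a b (k ⊖ suc n)))
      ≈⟨ anti-binomialˡ (suc (n * 2)) (λ k _ → term ε a b (k ⊖ suc n)) ⟨
    anti (suc (suc (n * 2))) (λ k l → binomial k l *ˢ term ε a b (k ⊖ suc n)) ∎
    where
    open ≈-Reasoning
    open SeriesSolver
    stepˡ : ∀ k l → k + l ≡ n * 2 → factor ε c a n *ˢ (binomial k l *ˢ term ε a b (k ⊖ n)) ≈
      binomial k l *ˢ (q l *ˢ term ε a b (suc k ⊖ n) +ˢ term ε a b (k ⊖ n))
    stepˡ k l k+l≡2n = begin
      (1ˢ +ˢ mono ε (a + n * c)) *ˢ (binomial k l *ˢ term ε a b (k ⊖ n))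
        ≈⟨ solve 3 (λ m g t → (con (+ 1) :+ m) :* (g :* t) := g :* (m :* t :+ t)) S.refl (mono ε (a + n * c)) (binomial k l) _ ⟩
      binomial k l *ˢ (mono ε (a + n * c) *ˢ term ε a b (k ⊖ n) +ˢ term ε a b (k ⊖ n))
        ≈⟨ S.*-congˡ (S.+-congʳ (term-sucˡ n l k n (trans
             (trans (sym (n*2≡n+n n)) (sym k+l≡2n)) (ℕₚ.+-comm k l)))) ⟩
      binomial k l *ˢ (q l *ˢ term ε a b (suc k ⊖ n) +ˢ term ε a b (k ⊖ n)) ∎
    stepʳ : ∀ k l → k + l ≡ suc (n * 2) → factor ε c b n *ˢ (binomial k l *ˢ term ε a b (k ⊖ n)) ≈
      binomial k l *ˢ (term ε a b (suc k ⊖ suc n) +ˢ q k *ˢ term ε a b (k ⊖ suc n))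
    stepʳ k l _ = begin
      (1ˢ +ˢ mono ε (b + n * c)) *ˢ (binomial k l *ˢ term ε a b (k ⊖ n))
        ≈⟨ solve 3 (λ m g t → (con (+ 1) :+ m) :* (g :* t) := g :* (t :+ m :* t)) S.refl (mono ε (b + n * c)) (binomial k l) _ ⟩
      binomial k l *ˢ (term ε a b (k ⊖ n) +ˢ mono ε (b + n * c) *ˢ term ε a b (k ⊖ n))
        ≈⟨ S.*-congˡ (S.+-cong shift (S.trans (S.*-congˡ shift)
             (term-sucʳ n k k (suc n) (ℕₚ.+-comm k (suc n))))) ⟩
      binomial k l *ˢ (term ε a b (suc k ⊖ suc n) +ˢ q k *ˢ term ε a b (k ⊖ suc n)) ∎
      where
      shift : term ε a b (k ⊖ n) ≈ term ε a b (suc k ⊖ suc n)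
      shift = S.reflexive (cong (term ε a b) (sym (ℤₚ.[1+m]⊖[1+n]≡m⊖n k n)))

  module _ .{{_ : NonZero b}} .{{_ : NonZero (a + b)}} where

    -- For precision K the finite form is taken at n = 2 K. On the diagonal k + l = 4 K, either both
    -- k and l are at least K and the binomial has reached its limit modulo q^K, or ∣ k - 2 K ∣ > K
    -- and the theta term itself vanishes modulo q^K.
    triple : Π -[1+ 0 ] c c *ˢ (Π ε c a *ˢ Π ε c b) ≈ theta ε a b
    triple = ≈[]⇒≈ λ K → ≈[]-trans
      (*ˢ-cong[] ≈[]-refl (*ˢ-cong[] (≈[]-sym (Π≈prod ε c a (K≤2K K))) (≈[]-sym (Π≈prod ε c b (K≤2K K)))))
      (≈[]-trans (≈⇒≈[] (S.trans (S.*-congˡ (finite (K * 2))) (S.sym (anti-*ˢ (K * 2 * 2) (Π -[1+ 0 ] c c) (λ k l → binomial k l *ˢ term ε a b (k ⊖ (K * 2)))))))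
      (≈[]-trans (anti-cong[] (K * 2 * 2) (limit K))
      (≈[]-trans (≈⇒≈[] (anti-range (term ε a b) (K * 2)))
        (partialTheta≈theta ε a b (K≤2K K)))))
      where
      K≤2K : ∀ K → K ≤ K * 2
      K≤2K K = ℕₚ.m≤m*n K 2

      vanish : ∀ K k l → K < ∣ k ⊖ (K * 2) ∣ →
        Π -[1+ 0 ] c c *ˢ (binomial k l *ˢ term ε a b (k ⊖ (K * 2))) ≈[ K ] term ε a b (k ⊖ (K * 2))
      vanish K k l K<∣j∣ = ≈[]-trans
        (*ˢ-cong[] ≈[]-refl (≈[]-trans (*ˢ-cong[] ≈[]-refl t≈0) (≈⇒≈[] (S.zeroʳ _))))
        (≈[]-trans (≈⇒≈[] (S.zeroʳ _)) (≈[]-sym t≈0))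
        where t≈0 = term-≈0 ε a b (k ⊖ (K * 2)) K<∣j∣

      limit : ∀ K k l → k + l ≡ K * 2 * 2 →
        Π -[1+ 0 ] c c *ˢ (binomial k l *ˢ term ε a b (k ⊖ (K * 2))) ≈[ K ] term ε a b (k ⊖ (K * 2))
      limit K k l k+l≡4K with K ≤? k | K ≤? l
      ... | yes K≤k | yes K≤l = ≈[]-trans (≈⇒≈[] (S.sym (S.*-assoc _ _ _)))
        (≈[]-trans (*ˢ-cong[] (binomial-limit K k l K≤k K≤l) ≈[]-refl) (≈⇒≈[] (S.*-identityˡ _)))
      ... | no K≰k | _ = vanish K k l (subst (K <_) (sym (ℤₚ.∣⊖∣-≤ (ℕₚ.≤-trans (ℕₚ.<⇒≤ k<K) (K≤2K K))))
        (ℕₚ.m+n≤o⇒m≤o∸n (suc K) (subst (suc K + k ≤_) (sym (n*2≡n+n K)) (subst (_≤ K + K) (ℕₚ.+-suc K k) (ℕₚ.+-monoʳ-≤ K k<K)))))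
        where k<K = ℕₚ.≰⇒> K≰k
      ... | yes _ | no K≰l = vanish K k l (subst (K <_) (ℤₚ.∣m⊖n∣≡∣n⊖m∣ (K * 2) k) (subst (K <_) (sym (ℤₚ.∣⊖∣-≤ 2K≤k)) (ℕₚ.m+n≤o⇒m≤o∸n (suc K) large)))
        where
        l<K = ℕₚ.≰⇒> K≰l
        open ℕₚ.≤-Reasoning
        large : suc K + K * 2 ≤ k
        large = ℕₚ.+-cancelʳ-≤ l _ _ (begin
          suc K + K * 2 + l ≡⟨ solve 3 (λ K m l → con 1 :+ K :+ m :+ l := con 1 :+ l :+ (K :+ m)) refl K (K * 2) l ⟩
          suc l + (K + K * 2) ≤⟨ ℕₚ.+-monoˡ-≤ (K + K * 2) l<K ⟩
          K + (K + K * 2) ≡⟨ solve 1 (λ K → K :+ (K :+ K :* con 2) := K :* con 2 :* con 2) refl K ⟩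
          K * 2 * 2 ≡⟨ k+l≡4K ⟨
          k + l ∎)
          where open +-*-Solver
        2K≤k : K * 2 ≤ k
        2K≤k = ℕₚ.≤-trans (ℕₚ.m≤n+m (K * 2) (suc K)) large

-- Product identities and dilation

∏-*ˢ : ∀ {f g} → Convergent f → Convergent g → ∏ f *ˢ ∏ g ≈ ∏ (λ k → f k *ˢ g k)
∏-*ˢ {f} {g} cf cg = ≈[]⇒≈ λ N → ≈[]-trans
  (*ˢ-cong[] (≈[]-sym (prod≈∏ cf ℕₚ.≤-refl)) (≈[]-sym (prod≈∏ cg ℕₚ.≤-refl)))
  (≈[]-trans (≈⇒≈[] (S.sym (prod-*ˢ f g N))) (prod≈∏ (*ˢ-convergent cf cg) ℕₚ.≤-refl))
  where
  *ˢ-convergent : ∀ {f g} → Convergent f → Convergent g → Convergent (λ k → f k *ˢ g k)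
  *ˢ-convergent cf cg k = ≈[]-trans (*ˢ-cong[] (cf k) (cg k)) (≈⇒≈[] (S.*-identityˡ 1ˢ))

∏-cong : ∀ {f g} → (∀ k → f k ≈ g k) → ∏ f ≈ ∏ g
∏-cong p = mk λ n → at (prod-cong p (suc n)) n

factor-cong : ∀ ε c r k d s l → r + k * c ≡ s + l * d → factor ε c r k ≈ factor ε d s l
factor-cong ε c r k d s l eq = S.+-congˡ (mono-cong refl eq)

-- Sorts the factors by the parity of their index; `Π-split₃` does so by the residue modulo 3.
Π-split₂ : ∀ ε c r .{{_ : NonZero c}} .{{_ : NonZero (c * 2)}} → Π ε c r ≈ Π ε (c * 2) r *ˢ Π ε (c * 2) (c + r)
Π-split₂ ε c r = ≈[]⇒≈ λ N → ≈[]-trans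
  (≈[]-sym (Π≈prod ε c r (ℕₚ.m≤m*n N 2)))
  (≈[]-trans (≈⇒≈[] (go N))
    (*ˢ-cong[] (Π≈prod ε (c * 2) r ℕₚ.≤-refl) (Π≈prod ε (c * 2) (c + r) ℕₚ.≤-refl)))
  where
  open SeriesSolver
  e₀ : ∀ r n c → r + n * 2 * c ≡ r + n * (c * 2)
  e₀ = solve-∀
  e₁ : ∀ r n c → r + (c + n * 2 * c) ≡ c + r + n * (c * 2)
  e₁ = solve-∀
  go : ∀ n → prod (factor ε c r) (n * 2) ≈ prod (factor ε (c * 2) r) n *ˢ prod (factor ε (c * 2) (c + r)) n
  go zero = S.sym (S.*-identityˡ 1ˢ)
  go (suc n) = S.trans
    (S.*-cong (S.*-cong (go n)
      (factor-cong ε c r (n * 2) (c * 2) r n (e₀ r n c)))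
      (factor-cong ε c r (suc (n * 2)) (c * 2) (c + r) n (e₁ r n c)))
    (solve 4 (λ p q x y → p :* q :* x :* y := p :* x :* (q :* y)) S.refl
      (prod (factor ε (c * 2) r) n) (prod (factor ε (c * 2) (c + r)) n) _ _)

Π-split₃ : ∀ ε c r .{{_ : NonZero c}} .{{_ : NonZero (c * 3)}} →
  Π ε c r ≈ Π ε (c * 3) r *ˢ Π ε (c * 3) (c + r) *ˢ Π ε (c * 3) (c + (c + r))
Π-split₃ ε c r = ≈[]⇒≈ λ N → ≈[]-trans
  (≈[]-sym (Π≈prod ε c r (ℕₚ.m≤m*n N 3)))
  (≈[]-trans (≈⇒≈[] (go N))
    (*ˢ-cong[] (*ˢ-cong[] (Π≈prod ε (c * 3) r ℕₚ.≤-refl) (Π≈prod ε (c * 3) (c + r) ℕₚ.≤-refl))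
      (Π≈prod ε (c * 3) (c + (c + r)) ℕₚ.≤-refl)))
  where
  open SeriesSolver
  e₀ : ∀ r n c → r + n * 3 * c ≡ r + n * (c * 3)
  e₀ = solve-∀
  e₁ : ∀ r n c → r + (c + n * 3 * c) ≡ c + r + n * (c * 3)
  e₁ = solve-∀
  e₂ : ∀ r n c → r + (c + (c + n * 3 * c)) ≡ c + (c + r) + n * (c * 3)
  e₂ = solve-∀
  go : ∀ n → prod (factor ε c r) (n * 3) ≈
    prod (factor ε (c * 3) r) n *ˢ prod (factor ε (c * 3) (c + r)) n *ˢ prod (factor ε (c * 3) (c + (c + r))) n
  go zero = S.sym (S.trans (S.*-identityʳ _) (S.*-identityˡ 1ˢ))
  go (suc n) = S.trans
    (S.*-cong (S.*-cong (S.*-cong (go n)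
      (factor-cong ε c r (n * 3) (c * 3) r n (e₀ r n c)))
      (factor-cong ε c r (suc (n * 3)) (c * 3) (c + r) n (e₁ r n c)))
      (factor-cong ε c r (suc (suc (n * 3))) (c * 3) (c + (c + r)) n (e₂ r n c)))
    (solve 6 (λ p q s x y z → p :* q :* s :* x :* y :* z := p :* x :* (q :* y) :* (s :* z)) S.refl
      (prod (factor ε (c * 3) r) n) (prod (factor ε (c * 3) (c + r)) n) (prod (factor ε (c * 3) (c + (c + r))) n) _ _ _)

Π-shift : ∀ ε c r .{{_ : NonZero c}} → Π ε c r ≈ (1ˢ +ˢ mono ε r) *ˢ Π ε c (c + r)
Π-shift ε c r = ≈[]⇒≈ λ N → ≈[]-trans
  (≈[]-sym (Π≈prod ε c r (ℕₚ.n≤1+n N)))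
  (≈[]-trans (≈⇒≈[] (go N)) (*ˢ-cong[] ≈[]-refl (Π≈prod ε c (c + r) ℕₚ.≤-refl)))
  where
  go : ∀ n → prod (factor ε c r) (suc n) ≈ (1ˢ +ˢ mono ε r) *ˢ prod (factor ε c (c + r)) n
  go zero = S.trans (S.*-identityˡ _) (S.trans (S.+-congˡ (mono-cong refl (ℕₚ.+-identityʳ r))) (S.sym (S.*-identityʳ _)))
  go (suc n) = S.trans (S.*-cong (go n) (factor-cong ε c r (suc n) c (c + r) n (e r n c))) (S.*-assoc _ _ _)
    where
    e : ∀ r n c → r + (c + n * c) ≡ c + r + n * c
    e = solve-∀

-- `g k` is (-q^k ; q^k)_∞. It serves intermediate expressions and disappears through f k · g k = f
-- (2 k).
f g : ℕ → Series
f k = Π -[1+ 0 ] k k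
g k = Π (+ 1) k k

f*g : ∀ k .{{_ : NonZero k}} → f k *ˢ g k ≈ f (k * 2)
f*g k = S.trans (∏-*ˢ (factor-convergent -[1+ 0 ] k k) (factor-convergent (+ 1) k k)) (∏-cong step)
  where
  open SeriesSolver
  doubled : ∀ i k → k + i * k + (k + i * k) ≡ k * 2 + i * (k * 2)
  doubled = solve-∀
  step : ∀ i → factor -[1+ 0 ] k k i *ˢ factor (+ 1) k k i ≈ factor -[1+ 0 ] (k * 2) (k * 2) i
  step i = begin
    (1ˢ +ˢ mono -[1+ 0 ] e) *ˢ (1ˢ +ˢ mono (+ 1) e) ≈⟨ S.*-congʳ (S.+-congˡ (mono-neg e)) ⟩
    (1ˢ +ˢ -ˢ mono (+ 1) e) *ˢ (1ˢ +ˢ mono (+ 1) e)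
      ≈⟨ solve 1 (λ m → (con (+ 1) :+ :- m) :* (con (+ 1) :+ m) := con (+ 1) :+ :- (m :* m)) S.refl (mono (+ 1) e) ⟩
    1ˢ +ˢ -ˢ (mono (+ 1) e *ˢ mono (+ 1) e)
      ≈⟨ S.+-congˡ (S.trans (S.-‿cong (mono-*ˢ (+ 1) (+ 1) e e)) (S.sym (mono-neg (e + e)))) ⟩
    1ˢ +ˢ mono -[1+ 0 ] (e + e)
      ≈⟨ S.+-congˡ (mono-cong refl (doubled i k)) ⟩
    factor -[1+ 0 ] (k * 2) (k * 2) i ∎
    where
    open ≈-Reasoning
    e = k + i * k

-- The triple product supplies the residues 1 and 2 modulo 3. Writing f 6 = f 3 · g 3 adds the
-- residue 0, the three classes combine to g 1, and f 1 · g 1 = f 2. The next identity is the same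
-- one with q² for q.
theta₁₂-product : theta (+ 1) 1 2 *ˢ (f 6 *ˢ f 1) ≈ f 2 *ˢ (f 3 *ˢ f 3)
theta₁₂-product = begin
  theta (+ 1) 1 2 *ˢ (f 6 *ˢ f 1)
    ≈⟨ S.*-cong (S.sym (JacobiTriple.triple (+ 1) refl 1 2)) (S.*-congʳ (S.sym (f*g 3))) ⟩
  f 3 *ˢ (Π (+ 1) 3 1 *ˢ Π (+ 1) 3 2) *ˢ (f 3 *ˢ g 3 *ˢ f 1)
    ≈⟨ solve 5 (λ f₃ x y g₃ f₁ → f₃ :* (x :* y) :* (f₃ :* g₃ :* f₁) := f₁ :* (x :* y :* g₃) :* (f₃ :* f₃)) S.refl
         (f 3) (Π (+ 1) 3 1) (Π (+ 1) 3 2) (g 3) (f 1) ⟩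
  f 1 *ˢ (Π (+ 1) 3 1 *ˢ Π (+ 1) 3 2 *ˢ g 3) *ˢ (f 3 *ˢ f 3)
    ≈⟨ S.*-congʳ (S.trans (S.*-congˡ (S.sym (Π-split₃ (+ 1) 1 1))) (f*g 1)) ⟩
  f 2 *ˢ (f 3 *ˢ f 3) ∎
  where
  open ≈-Reasoning
  open SeriesSolver

theta₂₄-product : theta (+ 1) 2 4 *ˢ (f 12 *ˢ f 2) ≈ f 4 *ˢ (f 6 *ˢ f 6)
theta₂₄-product = begin
  theta (+ 1) 2 4 *ˢ (f 12 *ˢ f 2)
    ≈⟨ S.*-cong (S.sym (JacobiTriple.triple (+ 1) refl 2 4)) (S.*-congʳ (S.sym (f*g 6))) ⟩
  f 6 *ˢ (Π (+ 1) 6 2 *ˢ Π (+ 1) 6 4) *ˢ (f 6 *ˢ g 6 *ˢ f 2)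
    ≈⟨ solve 5 (λ f₆ x y g₆ f₂ → f₆ :* (x :* y) :* (f₆ :* g₆ :* f₂) := f₂ :* (x :* y :* g₆) :* (f₆ :* f₆)) S.refl
         (f 6) (Π (+ 1) 6 2) (Π (+ 1) 6 4) (g 6) (f 2) ⟩
  f 2 *ˢ (Π (+ 1) 6 2 *ˢ Π (+ 1) 6 4 *ˢ g 6) *ˢ (f 6 *ˢ f 6)
    ≈⟨ S.*-congʳ (S.trans (S.*-congˡ (S.sym (Π-split₃ (+ 1) 2 2))) (f*g 2)) ⟩
  f 4 *ˢ (f 6 *ˢ f 6) ∎
  where
  open ≈-Reasoning
  open SeriesSolver

-- The first factor of `Π (+ 1) 3 0` is 1 + q^0 = 2. This is the origin of the evenness of H.
theta₀₃-product : theta (+ 1) 0 3 *ˢ f 3 ≈ const (+ 2) *ˢ (f 6 *ˢ f 6)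
theta₀₃-product = begin
  theta (+ 1) 0 3 *ˢ f 3 ≈⟨ S.*-congʳ (S.sym (JacobiTriple.triple (+ 1) refl 0 3)) ⟩
  f 3 *ˢ (Π (+ 1) 3 0 *ˢ g 3) *ˢ f 3 ≈⟨ S.*-congʳ (S.*-congˡ (S.*-congʳ (Π-shift (+ 1) 3 0))) ⟩
  f 3 *ˢ ((1ˢ +ˢ 1ˢ) *ˢ g 3 *ˢ g 3) *ˢ f 3
    ≈⟨ solve 2 (λ f₃ g₃ → f₃ :* ((con (+ 1) :+ con (+ 1)) :* g₃ :* g₃) :* f₃ := con (+ 2) :* (f₃ :* g₃ :* (f₃ :* g₃))) S.refl (f 3) (g 3) ⟩
  const (+ 2) *ˢ (f 3 *ˢ g 3 *ˢ (f 3 *ˢ g 3)) ≈⟨ S.*-congˡ (S.*-cong (f*g 3) (f*g 3)) ⟩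
  const (+ 2) *ˢ (f 6 *ˢ f 6) ∎
  where
  open ≈-Reasoning
  open SeriesSolver

-- The residues 1 and 5 modulo 6 come from the triple product, the residue 3 from g 3 in f 6 = f 3 ·
-- g 3, and the even ones from g 2 in f 4 = f 2 · g 2. Together they make g 1; the part of g 3 with
-- residue 0 remains as g 6 and turns f 6 into f 12.
theta₁₅-product : theta (+ 1) 1 5 *ˢ (f 1 *ˢ f 4 *ˢ f 6) ≈ f 2 *ˢ f 2 *ˢ (f 3 *ˢ f 12)
theta₁₅-product = begin
  theta (+ 1) 1 5 *ˢ (f 1 *ˢ f 4 *ˢ f 6)
    ≈⟨ S.*-cong (S.sym (JacobiTriple.triple (+ 1) refl 1 5)) (S.*-cong (S.*-congˡ (S.sym (f*g 2))) (S.trans (S.sym (f*g 3)) (S.*-congˡ (Π-split₂ (+ 1) 3 3)))) ⟩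
  f 6 *ˢ (Π (+ 1) 6 1 *ˢ Π (+ 1) 6 5) *ˢ (f 1 *ˢ (f 2 *ˢ g 2) *ˢ (f 3 *ˢ (Π (+ 1) 6 3 *ˢ g 6)))
    ≈⟨ solve 9 (λ f₆ x y f₁ f₂ g₂ f₃ z g₆ → f₆ :* (x :* y) :* (f₁ :* (f₂ :* g₂) :* (f₃ :* (z :* g₆)))
         := f₁ :* (x :* z :* y :* g₂) :* f₂ :* (f₃ :* (f₆ :* g₆))) S.refl
         (f 6) (Π (+ 1) 6 1) (Π (+ 1) 6 5) (f 1) (f 2) (g 2) (f 3) (Π (+ 1) 6 3) (g 6) ⟩
  f 1 *ˢ (Π (+ 1) 6 1 *ˢ Π (+ 1) 6 3 *ˢ Π (+ 1) 6 5 *ˢ g 2) *ˢ f 2 *ˢ (f 3 *ˢ (f 6 *ˢ g 6))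
    ≈⟨ S.*-cong (S.*-congʳ (S.trans (S.*-congˡ (S.trans (S.*-congʳ (S.sym (Π-split₃ (+ 1) 2 1))) (S.sym (Π-split₂ (+ 1) 1 1)))) (f*g 1)))
         (S.*-congˡ (f*g 6)) ⟩
  f 2 *ˢ f 2 *ˢ (f 3 *ˢ f 12) ∎
  where
  open ≈-Reasoning
  open SeriesSolver

-- Splitting the indices modulo 3 gives f k three factors of period 3 k, which are those of the
-- triple product with sign -1, a = k and b = 2 k.
pentagonal : ∀ k .{{_ : NonZero k}} .{{_ : NonZero (k * 3)}} .{{_ : NonZero (k + k)}} .{{_ : NonZero (k + (k + k))}} → f k ≈ theta -[1+ 0 ] k (k + k)
pentagonal k = S.trans (Π-split₃ -[1+ 0 ] k k) (S.trans
  (S.trans (S.*-comm _ _) (S.reflexive (cong (λ c → Π -[1+ 0 ] c (k + (k + k)) *ˢ (Π -[1+ 0 ] c k *ˢ Π -[1+ 0 ] c (k + k))) (triple-sum k))))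
  (JacobiTriple.triple -[1+ 0 ] refl k (k + k)))
  where
  triple-sum : ∀ k → k * 3 ≡ k + (k + k)
  triple-sum = solve-∀

-- Factor by factor, (1 + m)³ = 1 + m³ + 3 (m + m²) with m = -q^e. The explicit series Y keeps the
-- congruence modulo 3 an equation, open to the ring solver.
frobenius : ∀ k .{{_ : NonZero k}} → Σ Series λ Y → f k *ˢ f k *ˢ f k ≈ f (k * 3) +ˢ const (+ 3) *ˢ Y
frobenius k = Y , S.trans
  (S.trans (S.*-congʳ (∏-*ˢ conv conv)) (∏-*ˢ conv² conv))
  (mk λ n → trans (at (proj₂ (step (suc n))) n) (trans (+ˢ-at _ _ n)
    (trans (cong (Z._+_ (f (k * 3) n)) (trans (const-*ˢ-at (+ 3) (proj₁ (step (suc n))) n) (sym (const-*ˢ-at (+ 3) Y n))))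
      (sym (+ˢ-at (f (k * 3)) (const (+ 3) *ˢ Y) n)))))
  where
  open SeriesSolver
  tripled : ∀ i k → k + i * k + (k + i * k) + (k + i * k) ≡ k * 3 + i * (k * 3)
  tripled = solve-∀
  F G : ℕ → Series
  F = factor -[1+ 0 ] k k
  G = factor -[1+ 0 ] (k * 3) (k * 3)
  conv : Convergent F
  conv = factor-convergent -[1+ 0 ] k k
  conv² : Convergent (λ i → F i *ˢ F i)
  conv² i = ≈[]-trans (*ˢ-cong[] (conv i) (conv i)) (≈⇒≈[] (S.*-identityˡ 1ˢ))

  cube : ∀ i → Σ Series λ Z → F i *ˢ F i *ˢ F i ≈ G i +ˢ const (+ 3) *ˢ Z
  cube i = m +ˢ m *ˢ m , S.trans
    (solve 1 (λ m → (con (+ 1) :+ m) :* (con (+ 1) :+ m) :* (con (+ 1) :+ m)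
      := (con (+ 1) :+ m :* m :* m) :+ con (+ 3) :* (m :+ m :* m)) S.refl m)
    (S.+-congʳ (S.+-congˡ (S.trans (S.*-congʳ (mono-*ˢ -[1+ 0 ] -[1+ 0 ] e e)) (S.trans (mono-*ˢ (+ 1) -[1+ 0 ] (e + e) e)
      (mono-cong refl (tripled i k))))))
    where
    e = k + i * k
    m = mono -[1+ 0 ] e

  step : ∀ n → Σ Series λ Z → prod (λ i → F i *ˢ F i *ˢ F i) n ≈ prod G n +ˢ const (+ 3) *ˢ Z
  step zero = 0ˢ , S.sym (S.trans (S.+-congˡ (S.zeroʳ _)) (S.+-identityʳ _))
  step (suc n) = prod G n *ˢ V +ˢ U *ˢ G n +ˢ const (+ 3) *ˢ (U *ˢ V) , S.trans
    (S.*-cong (proj₂ (step n)) (proj₂ (cube n)))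
    (solve 4 (λ x y u v → (x :+ con (+ 3) :* u) :* (y :+ con (+ 3) :* v)
      := x :* y :+ con (+ 3) :* (x :* v :+ u :* y :+ con (+ 3) :* (u :* v))) S.refl (prod G n) (G n) U V)
    where
    U = proj₁ (step n)
    V = proj₁ (cube n)

  -- As in `∏`, the coefficient of q^n is read off n + 1 factors. Witnesses for different numbers of
  -- factors are never compared.
  Y : Series
  Y n = proj₁ (step (suc n)) n

-- The substitution q ↦ q³.
dilate : Series → Series
dilate X zero = X 0
dilate X (suc zero) = + 0
dilate X (suc (suc zero)) = + 0
dilate X (suc (suc (suc n))) = dilate (tail X) n

section₂ : Series → Series
section₂ X n = X (suc (suc (n * 3)))

-- Extracting a residue class of exponents modulo 3 is linear over series in q³: three steps of the
-- product recursion consume one coefficient of Y and two zeros.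
section₂-dilate-*ˢ : ∀ Y X → section₂ (dilate Y *ˢ X) ≈ Y *ˢ section₂ X
section₂-dilate-*ˢ Y X = mk (go Y)
  where
  go : ∀ Y n → (dilate Y *ˢ X) (suc (suc (n * 3))) ≡ (Y *ˢ section₂ X) n
  go Y zero = ℤₚ.+-identityʳ _
  go Y (suc n) = cong (Z._+_ (Y 0 Z.* X (suc (suc (suc n * 3)))))
    (trans (ℤₚ.+-identityˡ _) (trans (ℤₚ.+-identityˡ _) (go (tail Y) n)))

private
  dilate-linear : ∀ c X Y n → dilate (λ m → c Z.* X m Z.+ Y m) n ≡ c Z.* dilate X n Z.+ dilate Y n
  dilate-linear c X Y zero = refl
  dilate-linear c X Y (suc zero) = sym (trans (ℤₚ.+-identityʳ _) (ℤₚ.*-zeroʳ c))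
  dilate-linear c X Y (suc (suc zero)) = sym (trans (ℤₚ.+-identityʳ _) (ℤₚ.*-zeroʳ c))
  dilate-linear c X Y (suc (suc (suc n))) = dilate-linear c (tail X) (tail Y) n

  dilate-at-cong : ∀ {X Y} n → (∀ m → m ≤ n → X m ≡ Y m) → dilate X n ≡ dilate Y n
  dilate-at-cong zero p = p 0 z≤n
  dilate-at-cong (suc zero) p = refl
  dilate-at-cong (suc (suc zero)) p = refl
  dilate-at-cong (suc (suc (suc n))) p = dilate-at-cong n (λ m m≤n → p (suc m) (s≤s (ℕₚ.≤-trans m≤n (ℕₚ.m≤n+m n 2))))

dilate-cong[] : ∀ {N X Y} → X ≈[ N ] Y → dilate X ≈[ N ] dilate Y
dilate-cong[] p = mk λ n n<N → dilate-at-cong n (λ m m≤n → below p m (ℕₚ.≤-<-trans m≤n n<N))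

dilate-+ˢ : ∀ X Y → dilate (X +ˢ Y) ≈ dilate X +ˢ dilate Y
dilate-+ˢ X Y = mk λ n → trans
  (dilate-at-cong n (λ m _ → trans (+ˢ-at X Y m) (cong (Z._+ Y m) (sym (ℤₚ.*-identityˡ (X m))))))
  (trans (dilate-linear (+ 1) X Y n) (trans (cong (Z._+ dilate Y n) (ℤₚ.*-identityˡ (dilate X n))) (sym (+ˢ-at _ _ n))))

dilate-*ˢ : ∀ X Y → dilate (X *ˢ Y) ≈ dilate X *ˢ dilate Y
dilate-*ˢ X Y = mk (go X)
  where
  go : ∀ X n → dilate (X *ˢ Y) n ≡ (dilate X *ˢ dilate Y) n
  go X zero = refl
  go X (suc zero) = sym (trans (ℤₚ.+-identityʳ _) (ℤₚ.*-zeroʳ (X 0)))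
  go X (suc (suc zero)) = sym (trans (ℤₚ.+-identityʳ _) (ℤₚ.*-zeroʳ (X 0)))
  go X (suc (suc (suc n))) = trans (dilate-linear (X 0) (tail Y) (tail X *ˢ Y) n)
    (cong (Z._+_ (X 0 Z.* dilate (tail Y) n)) (trans (go (tail X) n) (sym (trans (ℤₚ.+-identityˡ _) (ℤₚ.+-identityˡ _)))))

dilate-mono : ∀ c e → dilate (mono c e) ≈ mono c (e * 3)
dilate-mono c e = mk (go e)
  where
  dilate-0 : ∀ n → dilate (λ _ → + 0) n ≡ + 0
  dilate-0 zero = refl
  dilate-0 (suc zero) = refl
  dilate-0 (suc (suc zero)) = refl
  dilate-0 (suc (suc (suc n))) = dilate-0 n

  go : ∀ e n → dilate (mono c e) n ≡ mono c (e * 3) n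
  go zero zero = refl
  go zero (suc zero) = refl
  go zero (suc (suc zero)) = refl
  go zero (suc (suc (suc n))) = dilate-0 n
  go (suc e) zero = refl
  go (suc e) (suc zero) = refl
  go (suc e) (suc (suc zero)) = refl
  go (suc e) (suc (suc (suc n))) = go e n

dilate-f : ∀ k .{{_ : NonZero k}} .{{_ : NonZero (k * 3)}} → dilate (f k) ≈ f (k * 3)
dilate-f k = ≈[]⇒≈ λ N → ≈[]-trans
  (dilate-cong[] (≈[]-sym (Π≈prod -[1+ 0 ] k k ℕₚ.≤-refl)))
  (≈[]-trans (≈⇒≈[] (go N)) (Π≈prod -[1+ 0 ] (k * 3) (k * 3) ℕₚ.≤-refl))
  where
  scaled : ∀ n k → (k + n * k) * 3 ≡ k * 3 + n * (k * 3)
  scaled = solve-∀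
  go : ∀ n → dilate (prod (factor -[1+ 0 ] k k) n) ≈ prod (factor -[1+ 0 ] (k * 3) (k * 3)) n
  go zero = dilate-mono (+ 1) 0
  go (suc n) = S.trans (dilate-*ˢ _ _) (S.*-cong (go n) (S.trans (dilate-+ˢ 1ˢ _)
    (S.+-cong (dilate-mono (+ 1) 0) (S.trans (dilate-mono -[1+ 0 ] (k + n * k))
      (mono-cong refl (scaled n k))))))

-- The generating function of RD49

countSeries : ℕ → Series
countSeries k r = + count k r

mono-*ˢ-≤ : ∀ e X r → e ≤ r → (mono (+ 1) e *ˢ X) r ≡ X (r ∸ e)
mono-*ˢ-≤ zero X r _ = trans (const-*ˢ-at (+ 1) X r) (ℤₚ.*-identityˡ (X r))
mono-*ˢ-≤ (suc e) X (suc r) (s≤s e≤r) = trans (ℤₚ.+-identityˡ _) (mono-*ˢ-≤ e X r e≤r)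

mono-*ˢ-≰ : ∀ e X r → ¬ e ≤ r → (mono (+ 1) e *ˢ X) r ≡ + 0
mono-*ˢ-≰ e X r e≰r = trans
  (below (*ˢ-cong[] {suc r} (mono-≈0 (+ 1) e (ℕₚ.≰⇒> e≰r)) ≈[]-refl) r ℕₚ.≤-refl)
  (trans (at (S.zeroˡ X) r) (0ˢ-at r))

geometric : ℕ → Series
geometric m = sumOver (upTo 9) (λ j → mono (+ 1) (j * m))

count-suc-∣ : ∀ k → 4 ∣ suc k → countSeries (suc k) ≈ countSeries k
count-suc-∣ k 4∣k+1 = mk λ r → cong +_ (go r)
  where
  go : ∀ r → count (suc k) r ≡ count k r
  go r with 4 ∣? suc k
  ... | yes _ = refl
  ... | no 4∤k+1 = contradiction 4∣k+1 4∤k+1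

-- Choosing the multiplicity j ≤ 8 of the part k + 1 shifts by q^(j (k + 1)), and `geometric` sums
-- these shifts.
count-suc-∤ : ∀ k → ¬ 4 ∣ suc k → countSeries (suc k) ≈ geometric (suc k) *ˢ countSeries k
count-suc-∤ k 4∤k+1 = mk λ r → trans (go r) (sym (expand (upTo 9) r))
  where
  shift : ℕ → Series
  shift j = mono (+ 1) (j * suc k) *ˢ countSeries k

  sumAt : List ℕ → ℕ → ℤ
  sumAt [] r = + 0
  sumAt (j ∷ js) r = shift j r Z.+ sumAt js r

  expand : ∀ js r → (sumOver js (λ j → mono (+ 1) (j * suc k)) *ˢ countSeries k) r ≡ sumAt js r
  expand [] r = trans (at (S.zeroˡ (countSeries k)) r) (0ˢ-at r)
  expand (j ∷ js) r = trans (at (S.distribʳ (countSeries k) _ _) r)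
    (trans (+ˢ-at _ _ r) (cong (Z._+_ (shift j r)) (expand js r)))

  hit : ∀ j {r} → j * suc k ≤ r → + count k (r ∸ j * suc k) ≡ shift j r
  hit j {r} le = sym (mono-*ˢ-≤ (j * suc k) (countSeries k) r le)

  miss : ∀ j {r} → ¬ j * suc k ≤ r → + 0 ≡ shift j r
  miss j {r} nle = sym (mono-*ˢ-≰ (j * suc k) (countSeries k) r nle)

  infixr 5 _⊞_
  _⊞_ : ∀ {x y u v} → + x ≡ u → + y ≡ v → + (x + y) ≡ u Z.+ v
  _⊞_ {x} {y} p q = trans (ℤₚ.pos-+ x y) (cong₂ Z._+_ p q)

  -- The conditions j (k + 1) ≤ r weaken as j decreases, so of the 2⁸ answer patterns only the nine
  -- with all yes before all no are possible.
  skipped : ∀ j {r} {A : Set} → ¬ j * suc k ≤ r → suc j * suc k ≤ r → A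
  skipped j nle le = contradiction (ℕₚ.≤-trans (ℕₚ.m≤n+m (j * suc k) (suc k)) le) nle

  -- The local function of count cannot be named, so its nine values are computed by cases.
  go : ∀ r → countSeries (suc k) r ≡ sumAt (upTo 9) r
  go r with 4 ∣? suc k
  ... | yes 4∣k+1 = contradiction 4∣k+1 4∤k+1
  ... | no _ with 1 * suc k ≤? r | 2 * suc k ≤? r | 3 * suc k ≤? r | 4 * suc k ≤? r
                | 5 * suc k ≤? r | 6 * suc k ≤? r | 7 * suc k ≤? r | 8 * suc k ≤? r
  ...   | yes p₁ | yes p₂ | yes p₃ | yes p₄ | yes p₅ | yes p₆ | yes p₇ | yes p₈ =
    hit 0 z≤n ⊞ hit 1 p₁ ⊞ hit 2 p₂ ⊞ hit 3 p₃ ⊞ hit 4 p₄ ⊞ hit 5 p₅ ⊞ hit 6 p₆ ⊞ hit 7 p₇ ⊞ hit 8 p₈ ⊞ refl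
  ...   | yes p₁ | yes p₂ | yes p₃ | yes p₄ | yes p₅ | yes p₆ | yes p₇ | no n₈ =
    hit 0 z≤n ⊞ hit 1 p₁ ⊞ hit 2 p₂ ⊞ hit 3 p₃ ⊞ hit 4 p₄ ⊞ hit 5 p₅ ⊞ hit 6 p₆ ⊞ hit 7 p₇ ⊞ miss 8 n₈ ⊞ refl
  ...   | yes p₁ | yes p₂ | yes p₃ | yes p₄ | yes p₅ | yes p₆ | no n₇ | no n₈ =
    hit 0 z≤n ⊞ hit 1 p₁ ⊞ hit 2 p₂ ⊞ hit 3 p₃ ⊞ hit 4 p₄ ⊞ hit 5 p₅ ⊞ hit 6 p₆ ⊞ miss 7 n₇ ⊞ miss 8 n₈ ⊞ refl
  ...   | yes p₁ | yes p₂ | yes p₃ | yes p₄ | yes p₅ | no n₆ | no n₇ | no n₈ =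
    hit 0 z≤n ⊞ hit 1 p₁ ⊞ hit 2 p₂ ⊞ hit 3 p₃ ⊞ hit 4 p₄ ⊞ hit 5 p₅ ⊞ miss 6 n₆ ⊞ miss 7 n₇ ⊞ miss 8 n₈ ⊞ refl
  ...   | yes p₁ | yes p₂ | yes p₃ | yes p₄ | no n₅ | no n₆ | no n₇ | no n₈ =
    hit 0 z≤n ⊞ hit 1 p₁ ⊞ hit 2 p₂ ⊞ hit 3 p₃ ⊞ hit 4 p₄ ⊞ miss 5 n₅ ⊞ miss 6 n₆ ⊞ miss 7 n₇ ⊞ miss 8 n₈ ⊞ refl
  ...   | yes p₁ | yes p₂ | yes p₃ | no n₄ | no n₅ | no n₆ | no n₇ | no n₈ =
    hit 0 z≤n ⊞ hit 1 p₁ ⊞ hit 2 p₂ ⊞ hit 3 p₃ ⊞ miss 4 n₄ ⊞ miss 5 n₅ ⊞ miss 6 n₆ ⊞ miss 7 n₇ ⊞ miss 8 n₈ ⊞ refl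
  ...   | yes p₁ | yes p₂ | no n₃ | no n₄ | no n₅ | no n₆ | no n₇ | no n₈ =
    hit 0 z≤n ⊞ hit 1 p₁ ⊞ hit 2 p₂ ⊞ miss 3 n₃ ⊞ miss 4 n₄ ⊞ miss 5 n₅ ⊞ miss 6 n₆ ⊞ miss 7 n₇ ⊞ miss 8 n₈ ⊞ refl
  ...   | yes p₁ | no n₂ | no n₃ | no n₄ | no n₅ | no n₆ | no n₇ | no n₈ =
    hit 0 z≤n ⊞ hit 1 p₁ ⊞ miss 2 n₂ ⊞ miss 3 n₃ ⊞ miss 4 n₄ ⊞ miss 5 n₅ ⊞ miss 6 n₆ ⊞ miss 7 n₇ ⊞ miss 8 n₈ ⊞ refl
  ...   | no n₁ | no n₂ | no n₃ | no n₄ | no n₅ | no n₆ | no n₇ | no n₈ =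
    hit 0 z≤n ⊞ miss 1 n₁ ⊞ miss 2 n₂ ⊞ miss 3 n₃ ⊞ miss 4 n₄ ⊞ miss 5 n₅ ⊞ miss 6 n₆ ⊞ miss 7 n₇ ⊞ miss 8 n₈ ⊞ refl
  ...   | no n₁ | yes p₂ | _ | _ | _ | _ | _ | _ = skipped 1 n₁ p₂
  ...   | _ | no n₂ | yes p₃ | _ | _ | _ | _ | _ = skipped 2 n₂ p₃
  ...   | _ | _ | no n₃ | yes p₄ | _ | _ | _ | _ = skipped 3 n₃ p₄
  ...   | _ | _ | _ | no n₄ | yes p₅ | _ | _ | _ = skipped 4 n₄ p₅
  ...   | _ | _ | _ | _ | no n₅ | yes p₆ | _ | _ = skipped 5 n₅ p₆
  ...   | _ | _ | _ | _ | _ | no n₆ | yes p₇ | _ = skipped 6 n₆ p₇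
  ...   | _ | _ | _ | _ | _ | _ | no n₇ | yes p₈ = skipped 7 n₇ p₈

1-q·geometric : ∀ m → (1ˢ +ˢ mono -[1+ 0 ] m) *ˢ geometric m ≈ 1ˢ +ˢ mono -[1+ 0 ] (9 * m)
1-q·geometric m = begin
  (1ˢ +ˢ mono -[1+ 0 ] m) *ˢ geometric m ≈⟨ S.*-congʳ (S.+-congˡ (mono-neg m)) ⟩
  (1ˢ +ˢ -ˢ mono (+ 1) m) *ˢ sumOver (upTo 9) q ≈⟨ telescope 9 0 ⟩
  q 0 +ˢ -ˢ q 9 ≈⟨ S.+-congˡ (S.sym (mono-neg (9 * m))) ⟩
  1ˢ +ˢ mono -[1+ 0 ] (9 * m) ∎
  where
  open ≈-Reasoning
  open SeriesSolver
  q : ℕ → Series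
  q j = mono (+ 1) (j * m)
  from : ℕ → ℕ → List ℕ
  from j zero = []
  from j (suc n) = j ∷ from (suc j) n
  telescope : ∀ n j → (1ˢ +ˢ -ˢ mono (+ 1) m) *ˢ sumOver (from j n) q ≈ q j +ˢ -ˢ q (n + j)
  telescope zero j = S.trans (S.zeroʳ _) (S.sym (S.-‿inverseʳ (q j)))
  telescope (suc n) j = begin
    (1ˢ +ˢ -ˢ mono (+ 1) m) *ˢ (q j +ˢ rest)
      ≈⟨ solve 3 (λ u x y → (con (+ 1) :+ :- u) :* (x :+ y) := x :+ :- (u :* x) :+ (con (+ 1) :+ :- u) :* y) S.refl
           (mono (+ 1) m) (q j) rest ⟩
    q j +ˢ -ˢ (mono (+ 1) m *ˢ q j) +ˢ (1ˢ +ˢ -ˢ mono (+ 1) m) *ˢ rest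
      ≈⟨ S.+-cong (S.+-congˡ (S.-‿cong (mono-*ˢ (+ 1) (+ 1) m (j * m)))) (telescope n (suc j)) ⟩
    q j +ˢ -ˢ q (suc j) +ˢ (q (suc j) +ˢ -ˢ q (n + suc j))
      ≈⟨ solve 3 (λ x y z → x :+ :- y :+ (y :+ :- z) := x :+ :- z) S.refl (q j) (q (suc j)) (q (n + suc j)) ⟩
    q j +ˢ -ˢ q (n + suc j) ≈⟨ S.+-congˡ (S.-‿cong (S.reflexive (cong q (ℕₚ.+-suc n j)))) ⟩
    q j +ˢ -ˢ q (suc n + j) ∎
    where
    rest : Series
    rest = sumOver (from (suc j) n) q

geometric-≈1 : ∀ m → geometric m ≈[ m ] 1ˢ
geometric-≈1 m = ≈[]-trans (+ˢ-cong[] ≈[]-refl (go 0 8)) (≈⇒≈[] (S.+-identityʳ 1ˢ))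
  where
  from : ℕ → ℕ → List ℕ
  from j zero = []
  from j (suc n) = suc j ∷ from (suc j) n
  go : ∀ j n → sumOver (from j n) (λ j → mono (+ 1) (j * m)) ≈[ m ] 0ˢ
  go j zero = ≈[]-refl
  go j (suc n) = ≈[]-trans (+ˢ-cong[] (mono-≈0 (+ 1) (suc j * m) (ℕₚ.m≤m+n m (j * m))) (go (suc j) n))
    (≈⇒≈[] (S.+-identityˡ 0ˢ))

RD : Series
RD n = + RD49 n

-- `RD` reads the diagonal of `count`. A part k + 1 either changes nothing or multiplies by a series
-- that is 1 modulo q^(k+1), so parts beyond n leave the coefficient of q^n alone.
countSeries≈RD : ∀ {N M} → N ≤ M → countSeries M ≈[ N ] RD
countSeries≈RD N≤M = mk λ n n<N → stable n (ℕₚ.<⇒≤ (ℕₚ.≤-trans n<N N≤M))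
  where
  step : ∀ k → countSeries (suc k) ≈[ suc k ] countSeries k
  step k = by-cases (4 ∣? suc k)
    where
    by-cases : Dec (4 ∣ suc k) → countSeries (suc k) ≈[ suc k ] countSeries k
    by-cases (yes 4∣k+1) = ≈⇒≈[] (count-suc-∣ k 4∣k+1)
    by-cases (no 4∤k+1) = ≈[]-trans (≈⇒≈[] (count-suc-∤ k 4∤k+1))
      (≈[]-trans (*ˢ-cong[] (geometric-≈1 (suc k)) ≈[]-refl) (≈⇒≈[] (S.*-identityˡ _)))

  stable : ∀ n {M} → n ≤ M → countSeries M n ≡ RD n
  stable n {M} n≤M = subst (λ m → countSeries m n ≡ RD n) (ℕₚ.m∸n+n≡m n≤M) (go (M ∸ n))
    where
    go : ∀ d → countSeries (d + n) n ≡ RD n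
    go zero = refl
    go (suc d) = trans (below (step (d + n)) n (s≤s (ℕₚ.m≤n+m n d))) (go d)

private
  factorₖ : ℕ → ℕ → Series
  factorₖ k = factor -[1+ 0 ] k k

  prodₖ : ℕ → ℕ → Series
  prodₖ k = prod (factorₖ k)

  factorₖ-geometric : ∀ k → factorₖ 1 k *ˢ geometric (suc k) ≈ factorₖ 9 k
  factorₖ-geometric k = S.trans (S.*-congʳ (S.+-congˡ (mono-cong refl (cong suc (ℕₚ.*-identityʳ k)))))
    (S.trans (1-q·geometric (suc k)) (S.+-congˡ (mono-cong refl (ℕₚ.*-comm 9 (suc k)))))

  4∤ : ∀ r K → suc r < 4 → ¬ 4 ∣ suc r + K * 4
  4∤ r K r<4 4∣ = ℕ∣.>⇒∤ r<4 (ℕ∣.∣m+n∣m⇒∣n (subst (4 ∣_) (ℕₚ.+-comm (suc r) (K * 4)) 4∣) (ℕ∣.n∣m*n K))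

  -- Parts are taken in blocks of four. In each block three parts m contribute (1 - q^m) ·
  -- `geometric m` = 1 - q^(9 m). The part m divisible by 4 contributes nothing to `countSeries`;
  -- its factors 1 - q^m and 1 - q^(9 m) are the next factors of f 4 and f 36.
  count-product : ∀ K → countSeries (K * 4) *ˢ (prodₖ 1 (K * 4) *ˢ prodₖ 36 K) ≈ prodₖ 9 (K * 4) *ˢ prodₖ 4 K
  count-product zero = S.trans (S.*-congʳ (mk λ { zero → refl ; (suc n) → refl }))
    (S.*-identityˡ _)
  count-product (suc K) = begin
    countSeries (4 + k) *ˢ (prodₖ 1 k *ˢ factorₖ 1 k *ˢ factorₖ 1 (1 + k) *ˢ factorₖ 1 (2 + k) *ˢ factorₖ 1 (3 + k) *ˢ (prodₖ 36 K *ˢ factorₖ 36 K))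
      ≈⟨ S.*-congʳ (S.trans (count-suc-∣ (3 + k) (ℕ∣.n∣m*n (suc K)))
           (S.trans (count-suc-∤ (2 + k) (4∤ 2 K ℕₚ.≤-refl)) (S.*-congˡ
           (S.trans (count-suc-∤ (1 + k) (4∤ 1 K (ℕₚ.n≤1+n 3))) (S.*-congˡ
             (count-suc-∤ k (4∤ 0 K (s≤s (s≤s z≤n))))))))) ⟩
    geometric (3 + k) *ˢ (geometric (2 + k) *ˢ (geometric (1 + k) *ˢ countSeries k)) *ˢ
      (prodₖ 1 k *ˢ factorₖ 1 k *ˢ factorₖ 1 (1 + k) *ˢ factorₖ 1 (2 + k) *ˢ factorₖ 1 (3 + k) *ˢ (prodₖ 36 K *ˢ factorₖ 36 K))
      ≈⟨ solve 11 (λ g₃ g₂ g₁ c p a b d e p′ e′ →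
           g₃ :* (g₂ :* (g₁ :* c)) :* (p :* a :* b :* d :* e :* (p′ :* e′))
           := c :* (p :* p′) :* ((a :* g₁) :* (b :* g₂) :* (d :* g₃) :* e′ :* e)) S.refl
           (geometric (3 + k)) (geometric (2 + k)) (geometric (1 + k)) (countSeries k) (prodₖ 1 k)
           (factorₖ 1 k) (factorₖ 1 (1 + k)) (factorₖ 1 (2 + k)) (factorₖ 1 (3 + k)) (prodₖ 36 K) (factorₖ 36 K) ⟩
    countSeries k *ˢ (prodₖ 1 k *ˢ prodₖ 36 K) *ˢ (factorₖ 1 k *ˢ geometric (1 + k) *ˢ (factorₖ 1 (1 + k) *ˢ geometric (2 + k))
      *ˢ (factorₖ 1 (2 + k) *ˢ geometric (3 + k)) *ˢ factorₖ 36 K *ˢ factorₖ 1 (3 + k))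
      ≈⟨ S.*-cong (count-product K) (S.*-cong (S.*-cong (S.*-cong (S.*-cong (factorₖ-geometric k) (factorₖ-geometric (1 + k)))
           (factorₖ-geometric (2 + k))) (factor-cong -[1+ 0 ] 36 36 K 9 9 (3 + k) (e₃₆ K)))
           (factor-cong -[1+ 0 ] 1 1 (3 + k) 4 4 K (e₄ K))) ⟩
    prodₖ 9 k *ˢ prodₖ 4 K *ˢ (factorₖ 9 k *ˢ factorₖ 9 (1 + k) *ˢ factorₖ 9 (2 + k) *ˢ factorₖ 9 (3 + k) *ˢ factorₖ 4 K)
      ≈⟨ solve 7 (λ p p′ a b c d e → p :* p′ :* (a :* b :* c :* d :* e) := p :* a :* b :* c :* d :* (p′ :* e)) S.refl
           (prodₖ 9 k) (prodₖ 4 K) (factorₖ 9 k) (factorₖ 9 (1 + k)) (factorₖ 9 (2 + k)) (factorₖ 9 (3 + k)) (factorₖ 4 K) ⟩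
    prodₖ 9 (4 + k) *ˢ (prodₖ 4 K *ˢ factorₖ 4 K) ∎
    where
    open ≈-Reasoning
    open SeriesSolver
    k = K * 4
    e₃₆ : ∀ K → 36 + K * 36 ≡ 9 + (3 + K * 4) * 9
    e₃₆ = solve-∀
    e₄ : ∀ K → 1 + (3 + K * 4) * 1 ≡ 4 + K * 4
    e₄ = solve-∀

RD-product : RD *ˢ (f 1 *ˢ f 36) ≈ f 9 *ˢ f 4
RD-product = ≈[]⇒≈ λ N → ≈[]-trans
  (*ˢ-cong[] (≈[]-sym (countSeries≈RD (ℕₚ.m≤m*n N 4)))
    (*ˢ-cong[] (≈[]-sym (Π≈prod -[1+ 0 ] 1 1 (ℕₚ.m≤m*n N 4))) (≈[]-sym (Π≈prod -[1+ 0 ] 36 36 ℕₚ.≤-refl))))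
  (≈[]-trans (≈⇒≈[] (count-product N))
    (*ˢ-cong[] (Π≈prod -[1+ 0 ] 9 9 (ℕₚ.m≤m*n N 4)) (Π≈prod -[1+ 0 ] 4 4 ℕₚ.≤-refl)))

-- Counting lattice points

∈-range : ∀ {M} j → ∣ j ∣ ≤ M → j ∈ range M
∈-range {zero} (+ zero) z≤n = here refl
∈-range {suc M} j ∣j∣≤ with ℕₚ.m≤n⇒m<n∨m≡n ∣j∣≤
... | inj₁ (s≤s ∣j∣≤M) = there (there (∈-range j ∣j∣≤M))
∈-range {suc M} (+ suc n) ∣j∣≤ | inj₂ refl = here refl
∈-range {suc M} -[1+ n ] ∣j∣≤ | inj₂ refl = there (here refl)

range-bounded : ∀ M → All (λ j → ∣ j ∣ ≤ M) (range M)
range-bounded zero = z≤n ∷ []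
range-bounded (suc M) = ℕₚ.≤-refl ∷ ℕₚ.≤-refl ∷ All.map ℕₚ.m≤n⇒m≤1+n (range-bounded M)

range-unique : ∀ M → Unique (range M)
range-unique zero = [] ∷ []
range-unique (suc M) =
  ((λ ()) ∷ All.map (λ { ∣j∣≤M refl → ℕₚ.<-irrefl refl ∣j∣≤M }) (range-bounded M))
  ∷ All.map (λ { ∣j∣≤M refl → ℕₚ.<-irrefl refl ∣j∣≤M }) (range-bounded M)
  ∷ range-unique M

same-length : {A : Set} {xs ys : List A} → Unique xs → Unique ys →
  (∀ {x} → x ∈ xs → x ∈ ys) → (∀ {x} → x ∈ ys → x ∈ xs) → length xs ≡ length ys
same-length xs! ys! xs⊆ys ys⊆xs = ↭-length (∼bag⇒↭ (unique∧set⇒bag xs! ys! (mk⇔ xs⊆ys ys⊆xs)))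

sumOver-cong : {A : Set} (xs : List A) {F G : A → Series} → (∀ x → F x ≈ G x) → sumOver xs F ≈ sumOver xs G
sumOver-cong [] p = S.refl
sumOver-cong (x ∷ xs) p = S.+-cong (p x) (sumOver-cong xs p)

sumOver-++ : {A : Set} (xs ys : List A) (F : A → Series) → sumOver (xs ++ ys) F ≈ sumOver xs F +ˢ sumOver ys F
sumOver-++ [] ys F = S.sym (S.+-identityˡ _)
sumOver-++ (x ∷ xs) ys F = S.trans (S.+-congˡ (sumOver-++ xs ys F)) (S.sym (S.+-assoc _ _ _))

sumOver-map : {A B : Set} (h : A → B) (xs : List A) (F : B → Series) → sumOver (map h xs) F ≈ sumOver xs (λ x → F (h x))
sumOver-map h [] F = S.refl
sumOver-map h (x ∷ xs) F = S.+-congˡ (sumOver-map h xs F)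

*ˢ-sumOver : {A : Set} (X : Series) (ys : List A) (G : A → Series) → X *ˢ sumOver ys G ≈ sumOver ys (λ y → X *ˢ G y)
*ˢ-sumOver X [] G = S.zeroʳ X
*ˢ-sumOver X (y ∷ ys) G = S.trans (S.distribˡ X _ _) (S.+-congˡ (*ˢ-sumOver X ys G))

sumOver-*ˢ : {A B : Set} (xs : List A) (ys : List B) (F : A → Series) (G : B → Series) →
  sumOver xs F *ˢ sumOver ys G ≈ sumOver (cartesianProduct xs ys) (λ p → F (proj₁ p) *ˢ G (proj₂ p))
sumOver-*ˢ [] ys F G = S.zeroˡ _
sumOver-*ˢ (x ∷ xs) ys F G = S.trans (S.distribʳ (sumOver ys G) (F x) (sumOver xs F)) (S.trans
  (S.+-cong (S.trans (*ˢ-sumOver (F x) ys G) (S.sym (sumOver-map (x ,_) ys (λ p → F (proj₁ p) *ˢ G (proj₂ p))))) (sumOver-*ˢ xs ys F G))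
  (S.sym (sumOver-++ (map (x ,_) ys) (cartesianProduct xs ys) (λ p → F (proj₁ p) *ˢ G (proj₂ p)))))

mono-at : ∀ c e → mono c e e ≡ c
mono-at c zero = refl
mono-at c (suc e) = mono-at c e

mono-off : ∀ c e n → ¬ e ≡ n → mono c e n ≡ + 0
mono-off c zero zero e≢n = contradiction refl e≢n
mono-off c zero (suc n) e≢n = refl
mono-off c (suc e) zero e≢n = refl
mono-off c (suc e) (suc n) e≢n = mono-off c e n (λ e≡n → e≢n (cong suc e≡n))

sumOver-mono-at : {A : Set} (xs : List A) (h : A → ℕ) (n : ℕ) →
  sumOver xs (λ x → mono (+ 1) (h x)) n ≡ + length (filter (λ x → h x ≟ n) xs)
sumOver-mono-at [] h n = 0ˢ-at n
sumOver-mono-at (x ∷ xs) h n = trans (+ˢ-at _ _ n) (by-cases (h x ≟ n))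
  where
  by-cases : Dec (h x ≡ n) → mono (+ 1) (h x) n Z.+ sumOver xs (λ x → mono (+ 1) (h x)) n
    ≡ + length (filter (λ x → h x ≟ n) (x ∷ xs))
  by-cases (yes hx≡n) = trans
    (cong₂ Z._+_ (trans (cong (mono (+ 1) (h x)) (sym hx≡n)) (mono-at (+ 1) (h x))) (sumOver-mono-at xs h n))
    (cong (λ ys → + length ys) (sym (Listₚ.filter-accept (λ x → h x ≟ n) hx≡n)))
  by-cases (no hx≢n) = trans
    (cong₂ Z._+_ (mono-off (+ 1) (h x) n hx≢n) (sumOver-mono-at xs h n))
    (trans (ℤₚ.+-identityˡ _) (cong (λ ys → + length ys) (sym (Listₚ.filter-reject (λ x → h x ≟ n) hx≢n))))

pairs : ℕ → List (ℤ × ℤ)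
pairs M = cartesianProduct (range M) (range M)

exponent₂ : ℕ → ℕ → ℕ → ℕ → ℤ × ℤ → ℕ
exponent₂ a b c d (i , j) = exponent a b i + exponent c d j

-- By `∣j∣≤1+exponent` the box contains all solutions when b and d are nonzero, so the length of
-- this list is the full representation number.
solutions : ℕ → ℕ → ℕ → ℕ → ℕ → List (ℤ × ℤ)
solutions a b c d n = filter (λ p → exponent₂ a b c d p ≟ n) (pairs (suc n))

∈-solutions : ∀ a b c d .{{_ : NonZero b}} .{{_ : NonZero d}} n p → exponent₂ a b c d p ≡ n → p ∈ solutions a b c d n
∈-solutions a b c d n (i , j) eq = ∈-filter⁺ (λ p → exponent₂ a b c d p ≟ n)
  (∈-cartesianProduct⁺
    (∈-range i (ℕₚ.≤-trans (∣j∣≤1+exponent a b i) (s≤s (subst (exponent a b i ≤_) eq (ℕₚ.m≤m+n (exponent a b i) (exponent c d j))))))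
    (∈-range j (ℕₚ.≤-trans (∣j∣≤1+exponent c d j) (s≤s (subst (exponent c d j ≤_) eq (ℕₚ.m≤n+m (exponent c d j) (exponent a b i)))))))
  eq

solutions-unique : ∀ a b c d n → Unique (solutions a b c d n)
solutions-unique a b c d n = Uniqueₚ.filter⁺ (λ p → exponent₂ a b c d p ≟ n) (Uniqueₚ.cartesianProduct⁺ (range-unique (suc n)) (range-unique (suc n)))

theta-*ˢ-theta : ∀ a b c d .{{_ : NonZero b}} .{{_ : NonZero d}} n →
  (theta (+ 1) a b *ˢ theta (+ 1) c d) n ≡ + length (solutions a b c d n)
theta-*ˢ-theta a b c d n = trans
  (below (*ˢ-cong[] (≈[]-sym (partialTheta≈theta (+ 1) a b {suc n} {suc n} ℕₚ.≤-refl))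
    (≈[]-sym (partialTheta≈theta (+ 1) c d {suc n} {suc n} ℕₚ.≤-refl))) n ℕₚ.≤-refl)
  (trans (at (sumOver-*ˢ (range (suc n)) (range (suc n)) (term (+ 1) a b) (term (+ 1) c d)) n)
  (trans (at (sumOver-cong (pairs (suc n)) {F = λ p → term (+ 1) a b (proj₁ p) *ˢ term (+ 1) c d (proj₂ p)}
      {G = λ p → mono (+ 1) (exponent₂ a b c d p)} monomial) n)
    (sumOver-mono-at (pairs (suc n)) (exponent₂ a b c d) n)))
  where
  monomial : ∀ p → term (+ 1) a b (proj₁ p) *ˢ term (+ 1) c d (proj₂ p) ≈ mono (+ 1) (exponent₂ a b c d p)
  monomial (i , j) = S.trans (mono-*ˢ ((+ 1) Z.^ ∣ i ∣) ((+ 1) Z.^ ∣ j ∣) (exponent a b i) (exponent c d j))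
    (mono-cong {e = exponent a b i + exponent c d j} (cong₂ Z._*_ (ℤₚ.^-zeroˡ ∣ i ∣) (ℤₚ.^-zeroˡ ∣ j ∣)) refl)

triangular-ℤ : ∀ n → + 2 Z.* + triangular n ≡ + n Z.* (+ n Z.+ + 1)
triangular-ℤ zero = refl
triangular-ℤ (suc n) = begin
  + 2 Z.* + (suc n + triangular n) ≡⟨ cong (Z._*_ (+ 2)) (ℤₚ.pos-+ (suc n) (triangular n)) ⟩
  + 2 Z.* (+ suc n Z.+ + triangular n) ≡⟨ ℤₚ.*-distribˡ-+ (+ 2) (+ suc n) (+ triangular n) ⟩
  + 2 Z.* + suc n Z.+ + 2 Z.* + triangular n ≡⟨ cong (Z._+_ (+ 2 Z.* + suc n)) (triangular-ℤ n) ⟩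
  + 2 Z.* + suc n Z.+ + n Z.* (+ n Z.+ + 1) ≡⟨ lemma (+ n) ⟩
  + suc n Z.* (+ suc n Z.+ + 1) ∎
  where
  open ≡-Reasoning
  lemma : ∀ x → + 2 Z.* (+ 1 Z.+ x) Z.+ x Z.* (x Z.+ + 1) ≡ (+ 1 Z.+ x) Z.* (+ 1 Z.+ x Z.+ + 1)
  lemma = ℤTactic.solve-∀

tri-ℤ : ∀ j → + 2 Z.* + tri j ≡ j Z.* (j Z.+ + 1)
tri-ℤ (+ n) = triangular-ℤ n
tri-ℤ -[1+ n ] = trans (triangular-ℤ n) (lemma (+ n))
  where
  lemma : ∀ x → x Z.* (x Z.+ + 1) ≡ Z.- (+ 1 Z.+ x) Z.* (Z.- (+ 1 Z.+ x) Z.+ + 1)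
  lemma = ℤTactic.solve-∀

-- Doubling removes the halves, so that statements about exponents become polynomial identities over
-- ℤ.
exponent-ℤ : ∀ a b j → + 2 Z.* + exponent a b j ≡ + a Z.* (j Z.* (j Z.+ + 1)) Z.+ + b Z.* (j Z.* (j Z.- + 1))
exponent-ℤ a b j = begin
  + 2 Z.* + (a * tri j + b * tri (Z.- j))
    ≡⟨ cong (Z._*_ (+ 2)) (trans (ℤₚ.pos-+ (a * tri j) (b * tri (Z.- j))) (cong₂ Z._+_ (ℤₚ.pos-* a (tri j)) (ℤₚ.pos-* b (tri (Z.- j))))) ⟩
  + 2 Z.* (+ a Z.* + tri j Z.+ + b Z.* + tri (Z.- j)) ≡⟨ regroup (+ a) (+ b) (+ tri j) (+ tri (Z.- j)) ⟩
  + a Z.* (+ 2 Z.* + tri j) Z.+ + b Z.* (+ 2 Z.* + tri (Z.- j))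
    ≡⟨ cong₂ (λ x y → + a Z.* x Z.+ + b Z.* y) (tri-ℤ j) (trans (tri-ℤ (Z.- j)) (reflect j)) ⟩
  + a Z.* (j Z.* (j Z.+ + 1)) Z.+ + b Z.* (j Z.* (j Z.- + 1)) ∎
  where
  open ≡-Reasoning
  regroup : ∀ a b s t → + 2 Z.* (a Z.* s Z.+ b Z.* t) ≡ a Z.* (+ 2 Z.* s) Z.+ b Z.* (+ 2 Z.* t)
  regroup = ℤTactic.solve-∀
  reflect : ∀ j → Z.- j Z.* (Z.- j Z.+ + 1) ≡ j Z.* (j Z.- + 1)
  reflect = ℤTactic.solve-∀

quadratic : ℕ → ℕ → ℤ → ℤ
quadratic a b j = + a Z.* (j Z.* (j Z.+ + 1)) Z.+ + b Z.* (j Z.* (j Z.- + 1))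

exponent₂-ℤ : ∀ a b c d p → + 2 Z.* + exponent₂ a b c d p ≡ quadratic a b (proj₁ p) Z.+ quadratic c d (proj₂ p)
exponent₂-ℤ a b c d (i , j) = trans (cong (Z._*_ (+ 2)) (ℤₚ.pos-+ (exponent a b i) (exponent c d j)))
  (trans (ℤₚ.*-distribˡ-+ (+ 2) (+ exponent a b i) (+ exponent c d j)) (cong₂ Z._+_ (exponent-ℤ a b i) (exponent-ℤ c d j)))

private
  -- Multiplication by 1 + √-2, for the norm forms attached to the two sides.
  φ : ℤ × ℤ → ℤ × ℤ
  φ (a , c) = (a Z.+ + 2 Z.* c Z.- + 1) , (a Z.- c)

  double-injective : ∀ {m n} → + 2 Z.* + m ≡ + 2 Z.* + n → m ≡ n
  double-injective {m} {n} eq = ℤₚ.+-injective (ℤₚ.*-cancelˡ-≡ (+ 2) (+ m) (+ n) eq)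

  double-2+n*3 : ∀ n → + 2 Z.* + (2 + n * 3) ≡ + 4 Z.+ + 3 Z.* (+ 2 Z.* + n)
  double-2+n*3 n = trans (cong (λ x → + 2 Z.* (+ 2 Z.+ x)) (ℤₚ.pos-* n 3)) (lemma (+ n))
    where
    lemma : ∀ x → + 2 Z.* (+ 2 Z.+ x Z.* + 3) ≡ + 4 Z.+ + 3 Z.* (+ 2 Z.* x)
    lemma = ℤTactic.solve-∀

  -- Put x = 6 a - 3, y = 6 c - 2, and u = 6 i - 1, v = 6 j - 1 for (i , j) = φ (a , c). Then (1 +
  -- √-2)(x - y √-2) = u + v √-2. Taking norms, u² + 2 v² = 3 (x² + 2 y²), that is 24 e′ + 3 = 3 (24
  -- e + 17) for the two exponents, whence e′ = 3 e + 2.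
  φ-exponent : ∀ p → exponent₂ 1 2 2 4 (φ p) ≡ 2 + exponent₂ 0 3 1 5 p * 3
  φ-exponent (a , c) = double-injective (trans (exponent₂-ℤ 1 2 2 4 (φ (a , c))) (trans (lemma a c)
    (sym (trans (double-2+n*3 (exponent₂ 0 3 1 5 (a , c))) (cong (λ x → + 4 Z.+ + 3 Z.* x) (exponent₂-ℤ 0 3 1 5 (a , c)))))))
    where
    lemma : ∀ a c → let i = a Z.+ + 2 Z.* c Z.- + 1 ; j = a Z.- c in
      (+ 1 Z.* (i Z.* (i Z.+ + 1)) Z.+ + 2 Z.* (i Z.* (i Z.- + 1))) Z.+ (+ 2 Z.* (j Z.* (j Z.+ + 1)) Z.+ + 4 Z.* (j Z.* (j Z.- + 1)))
      ≡ + 4 Z.+ + 3 Z.* ((+ 0 Z.* (a Z.* (a Z.+ + 1)) Z.+ + 3 Z.* (a Z.* (a Z.- + 1))) Z.+ (+ 1 Z.* (c Z.* (c Z.+ + 1)) Z.+ + 5 Z.* (c Z.* (c Z.- + 1))))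
    lemma = ℤTactic.solve-∀

  φ-injective : ∀ {p q} → φ p ≡ φ q → p ≡ q
  φ-injective {a , c} {a′ , c′} eq = cong₂ _,_ (trans (first a c) (trans (cong₂ Z._+_ (cong proj₂ eq) c≡c′) (sym (first a′ c′)))) c≡c′
    where
    first : ∀ a c → a ≡ a Z.- c Z.+ c
    first = ℤTactic.solve-∀
    thrice : ∀ a c → + 3 Z.* c ≡ a Z.+ + 2 Z.* c Z.- + 1 Z.- (a Z.- c) Z.+ + 1
    thrice = ℤTactic.solve-∀
    c≡c′ : c ≡ c′
    c≡c′ = ℤₚ.*-cancelˡ-≡ (+ 3) c c′ (trans (thrice a c)
      (trans (cong₂ (λ x y → x Z.- y Z.+ + 1) (cong proj₁ eq) (cong proj₂ eq)) (sym (thrice a′ c′))))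

  -- Inverting φ asks for 3 ∣ i - j + 1. Modulo 3, twice the exponent is j - i, while the hypothesis
  -- makes it 4 + 6 n, so j - i is 1.
  φ-surjective : ∀ n p → exponent₂ 1 2 2 4 p ≡ 2 + n * 3 → Σ (ℤ × ℤ) λ q → p ≡ φ q
  φ-surjective n (i , j) eq = (j Z.+ c , c) , cong₂ _,_ (trans (shift i) (trans (cong (Z._+_ i) (sym diff)) (first i j (+ n)))) (second j c)
    where
    -- The solution of 3 c = i − j + 1, with the division carried out by means of eq.
    c = i Z.* i Z.+ + 2 Z.* (j Z.* j) Z.- j Z.- + 2 Z.* + n Z.- + 1
    shift : ∀ i → i ≡ i Z.+ + 0
    shift i = sym (ℤₚ.+-identityʳ i)
    second : ∀ j c → j ≡ j Z.+ c Z.- c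
    second = ℤTactic.solve-∀
    Q : ℤ
    Q = quadratic 1 2 i Z.+ quadratic 2 4 j
    -- Added to i, this zero turns the equation for the first component into a polynomial identity
    -- in i, j and n.
    diff : Q Z.- (+ 4 Z.+ + 3 Z.* (+ 2 Z.* + n)) ≡ + 0
    diff = ℤₚ.i≡j⇒i-j≡0 {Q} (trans (sym (exponent₂-ℤ 1 2 2 4 (i , j))) (trans (cong (λ m → + 2 Z.* + m) eq) (double-2+n*3 n)))
    first : ∀ i j n → let c = i Z.* i Z.+ + 2 Z.* (j Z.* j) Z.- j Z.- + 2 Z.* n Z.- + 1 in
      i Z.+ ((+ 1 Z.* (i Z.* (i Z.+ + 1)) Z.+ + 2 Z.* (i Z.* (i Z.- + 1))) Z.+ (+ 2 Z.* (j Z.* (j Z.+ + 1)) Z.+ + 4 Z.* (j Z.* (j Z.- + 1)))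
        Z.- (+ 4 Z.+ + 3 Z.* (+ 2 Z.* n))) ≡ (j Z.+ c) Z.+ + 2 Z.* c Z.- + 1
    first = ℤTactic.solve-∀

theta₁₂-theta₂₄-section₂ : section₂ (theta (+ 1) 1 2 *ˢ theta (+ 1) 2 4) ≈ theta (+ 1) 0 3 *ˢ theta (+ 1) 1 5
theta₁₂-theta₂₄-section₂ = mk λ n → trans (theta-*ˢ-theta 1 2 2 4 (2 + n * 3)) (trans (cong +_ (counts n)) (sym (theta-*ˢ-theta 0 3 1 5 n)))
  where
  counts : ∀ n → length (solutions 1 2 2 4 (2 + n * 3)) ≡ length (solutions 0 3 1 5 n)
  counts n = trans
    (same-length (solutions-unique 1 2 2 4 (2 + n * 3)) (Uniqueₚ.map⁺ φ-injective (solutions-unique 0 3 1 5 n)) to from)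
    (Listₚ.length-map φ (solutions 0 3 1 5 n))
    where
    to : ∀ {p} → p ∈ solutions 1 2 2 4 (2 + n * 3) → p ∈ map φ (solutions 0 3 1 5 n)
    to {p} p∈ with eq ← proj₂ (∈-filter⁻ (λ p → exponent₂ 1 2 2 4 p ≟ 2 + n * 3) {xs = pairs (3 + n * 3)} p∈)
      with q , refl ← φ-surjective n p eq =
      ∈-map⁺ φ {x = q} (∈-solutions 0 3 1 5 n q (ℕₚ.*-cancelʳ-≡ _ _ 3 (ℕₚ.+-cancelˡ-≡ 2 _ _ (trans (sym (φ-exponent q)) eq))))
    from : ∀ {p} → p ∈ map φ (solutions 0 3 1 5 n) → p ∈ solutions 1 2 2 4 (2 + n * 3)
    from p∈ with q , q∈ , refl ← ∈-map⁻ φ p∈ = ∈-solutions 1 2 2 4 (2 + n * 3) (φ q) (trans (φ-exponent q)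
      (cong (λ m → 2 + m * 3) (proj₂ (∈-filter⁻ (λ p → exponent₂ 0 3 1 5 p ≟ n) {xs = pairs (suc n)} q∈))))

-- The congruence

f-at-0 : ∀ k .{{_ : NonZero k}} → f k 0 ≡ + 1
f-at-0 k = Π-at-0 -[1+ 0 ] k k

*ˢ-at-0 : ∀ X Y → X 0 ≡ + 1 → Y 0 ≡ + 1 → (X *ˢ Y) 0 ≡ + 1
*ˢ-at-0 X Y p q = cong₂ Z._*_ p q

-- The product formulas give f 4 / f 1 = θ 1 2 · θ 2 4 · f 12 / (f 3 ² · f 6); this is inserted into
-- `RD-product` with denominators cleared. Outside `RD` and the thetas, every index is a multiple of
-- 3.
RD-theta : f 36 *ˢ (f 3 *ˢ f 3) *ˢ f 6 *ˢ RD ≈ f 9 *ˢ f 12 *ˢ (theta (+ 1) 1 2 *ˢ theta (+ 1) 2 4)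
RD-theta = *ˢ-cancelˡ u u0≡1 (begin
  u *ˢ (f 36 *ˢ (f 3 *ˢ f 3) *ˢ f 6 *ˢ RD)
    ≈⟨ solve 7 (λ f₁ f₂ f₄ f₆ f₃₆ f₃ r → f₁ :* f₂ :* (f₄ :* f₆) :* (f₃₆ :* (f₃ :* f₃) :* f₆ :* r)
         := r :* (f₁ :* f₃₆) :* ((f₂ :* (f₃ :* f₃)) :* (f₄ :* (f₆ :* f₆)))) S.refl
         (f 1) (f 2) (f 4) (f 6) (f 36) (f 3) RD ⟩
  RD *ˢ (f 1 *ˢ f 36) *ˢ ((f 2 *ˢ (f 3 *ˢ f 3)) *ˢ (f 4 *ˢ (f 6 *ˢ f 6)))
    ≈⟨ S.*-cong RD-product (S.*-cong (S.sym theta₁₂-product) (S.sym theta₂₄-product)) ⟩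
  f 9 *ˢ f 4 *ˢ ((theta (+ 1) 1 2 *ˢ (f 6 *ˢ f 1)) *ˢ (theta (+ 1) 2 4 *ˢ (f 12 *ˢ f 2)))
    ≈⟨ solve 8 (λ f₁ f₂ f₄ f₆ f₉ f₁₂ s t → f₉ :* f₄ :* ((s :* (f₆ :* f₁)) :* (t :* (f₁₂ :* f₂)))
         := f₁ :* f₂ :* (f₄ :* f₆) :* (f₉ :* f₁₂ :* (s :* t))) S.refl
         (f 1) (f 2) (f 4) (f 6) (f 9) (f 12) (theta (+ 1) 1 2) (theta (+ 1) 2 4) ⟩
  u *ˢ (f 9 *ˢ f 12 *ˢ (theta (+ 1) 1 2 *ˢ theta (+ 1) 2 4)) ∎)
  where
  open ≈-Reasoning
  open SeriesSolver
  u : Series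
  u = f 1 *ˢ f 2 *ˢ (f 4 *ˢ f 6)
  u0≡1 : u 0 ≡ + 1
  u0≡1 = *ˢ-at-0 (f 1 *ˢ f 2) (f 4 *ˢ f 6) (*ˢ-at-0 (f 1) (f 2) (f-at-0 1) (f-at-0 2)) (*ˢ-at-0 (f 4) (f 6) (f-at-0 4) (f-at-0 6))

section₂-cong : ∀ {X Y} → X ≈ Y → section₂ X ≈ section₂ Y
section₂-cong p = mk λ n → at p (suc (suc (n * 3)))

H : Series
H = section₂ RD

-- The factors f (3 k) in `RD-theta` are dilations of f k, so taking the section merely divides
-- their indices by 3.
H-theta : f 12 *ˢ (f 1 *ˢ f 1) *ˢ f 2 *ˢ H ≈ f 3 *ˢ f 4 *ˢ (theta (+ 1) 0 3 *ˢ theta (+ 1) 1 5)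
H-theta = begin
  f 12 *ˢ (f 1 *ˢ f 1) *ˢ f 2 *ˢ H ≈⟨ section₂-dilate-*ˢ (f 12 *ˢ (f 1 *ˢ f 1) *ˢ f 2) RD ⟨
  section₂ (dilate (f 12 *ˢ (f 1 *ˢ f 1) *ˢ f 2) *ˢ RD)
    ≈⟨ section₂-cong (S.*-congʳ (S.trans (dilate-*ˢ (f 12 *ˢ (f 1 *ˢ f 1)) (f 2))
         (S.*-cong (S.trans (dilate-*ˢ (f 12) (f 1 *ˢ f 1)) (S.*-cong (dilate-f 12)
           (S.trans (dilate-*ˢ (f 1) (f 1)) (S.*-cong (dilate-f 1) (dilate-f 1))))) (dilate-f 2)))) ⟩
  section₂ (f 36 *ˢ (f 3 *ˢ f 3) *ˢ f 6 *ˢ RD) ≈⟨ section₂-cong RD-theta ⟩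
  section₂ (f 9 *ˢ f 12 *ˢ (theta (+ 1) 1 2 *ˢ theta (+ 1) 2 4))
    ≈⟨ section₂-cong (S.*-congʳ (S.trans (dilate-*ˢ (f 3) (f 4)) (S.*-cong (dilate-f 3) (dilate-f 4)))) ⟨
  section₂ (dilate (f 3 *ˢ f 4) *ˢ (theta (+ 1) 1 2 *ˢ theta (+ 1) 2 4)) ≈⟨ section₂-dilate-*ˢ (f 3 *ˢ f 4) _ ⟩
  f 3 *ˢ f 4 *ˢ section₂ (theta (+ 1) 1 2 *ˢ theta (+ 1) 2 4) ≈⟨ S.*-congˡ theta₁₂-theta₂₄-section₂ ⟩
  f 3 *ˢ f 4 *ˢ (theta (+ 1) 0 3 *ˢ theta (+ 1) 1 5) ∎
  where open ≈-Reasoning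

H-product : f 1 *ˢ f 1 *ˢ f 1 *ˢ H ≈ const (+ 2) *ˢ (f 2 *ˢ f 3 *ˢ f 6)
H-product = *ˢ-cancelˡ u u0≡1 (begin
  u *ˢ (f 1 *ˢ f 1 *ˢ f 1 *ˢ H)
    ≈⟨ solve 7 (λ f₁ f₂ f₃ f₄ f₆ f₁₂ h → f₁₂ :* f₂ :* (f₃ :* f₄ :* f₆) :* (f₁ :* f₁ :* f₁ :* h)
         := f₁₂ :* (f₁ :* f₁) :* f₂ :* h :* (f₃ :* (f₁ :* f₄ :* f₆))) S.refl (f 1) (f 2) (f 3) (f 4) (f 6) (f 12) H ⟩
  f 12 *ˢ (f 1 *ˢ f 1) *ˢ f 2 *ˢ H *ˢ (f 3 *ˢ (f 1 *ˢ f 4 *ˢ f 6)) ≈⟨ S.*-congʳ H-theta ⟩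
  f 3 *ˢ f 4 *ˢ (theta (+ 1) 0 3 *ˢ theta (+ 1) 1 5) *ˢ (f 3 *ˢ (f 1 *ˢ f 4 *ˢ f 6))
    ≈⟨ solve 6 (λ f₁ f₃ f₄ f₆ s t → f₃ :* f₄ :* (s :* t) :* (f₃ :* (f₁ :* f₄ :* f₆))
         := f₃ :* f₄ :* ((s :* f₃) :* (t :* (f₁ :* f₄ :* f₆)))) S.refl (f 1) (f 3) (f 4) (f 6) (theta (+ 1) 0 3) (theta (+ 1) 1 5) ⟩
  f 3 *ˢ f 4 *ˢ ((theta (+ 1) 0 3 *ˢ f 3) *ˢ (theta (+ 1) 1 5 *ˢ (f 1 *ˢ f 4 *ˢ f 6)))
    ≈⟨ S.*-congˡ (S.*-cong theta₀₃-product theta₁₅-product) ⟩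
  f 3 *ˢ f 4 *ˢ ((const (+ 2) *ˢ (f 6 *ˢ f 6)) *ˢ (f 2 *ˢ f 2 *ˢ (f 3 *ˢ f 12)))
    ≈⟨ solve 5 (λ f₂ f₃ f₄ f₆ f₁₂ → f₃ :* f₄ :* ((con (+ 2) :* (f₆ :* f₆)) :* (f₂ :* f₂ :* (f₃ :* f₁₂)))
         := f₁₂ :* f₂ :* (f₃ :* f₄ :* f₆) :* (con (+ 2) :* (f₂ :* f₃ :* f₆))) S.refl (f 2) (f 3) (f 4) (f 6) (f 12) ⟩
  u *ˢ (const (+ 2) *ˢ (f 2 *ˢ f 3 *ˢ f 6)) ∎)
  where
  open ≈-Reasoning
  open SeriesSolver
  u : Series
  u = f 12 *ˢ f 2 *ˢ (f 3 *ˢ f 4 *ˢ f 6)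
  u0≡1 : u 0 ≡ + 1
  u0≡1 = *ˢ-at-0 (f 12 *ˢ f 2) (f 3 *ˢ f 4 *ˢ f 6) (*ˢ-at-0 (f 12) (f 2) (f-at-0 12) (f-at-0 2))
    (*ˢ-at-0 (f 3 *ˢ f 4) (f 6) (*ˢ-at-0 (f 3) (f 4) (f-at-0 3) (f-at-0 4)) (f-at-0 6))

const-∣ : ∀ c X n → c ℤ∣.∣ (const c *ˢ X) n
const-∣ c X n = ℤ∣.divides (X n) (trans (const-*ˢ-at c X n) (ℤₚ.*-comm c (X n)))

2∣H : ∀ n → + 2 ℤ∣.∣ H n
2∣H n = ∣-cancel (+ 2) (f 1 *ˢ f 1 *ˢ f 1) H (suc n)
  (*ˢ-at-0 (f 1 *ˢ f 1) (f 1) (*ˢ-at-0 (f 1) (f 1) (f-at-0 1) (f-at-0 1)) (f-at-0 1))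
  (λ m _ → subst (+ 2 ℤ∣.∣_) (sym (at H-product m)) (const-∣ (+ 2) (f 2 *ˢ f 3 *ˢ f 6) m)) n ℕₚ.≤-refl

-- Writing f 1 ³ = f 3 + 3 Y in `H-product` gives f 3 · (H - 2 · f 2 · f 6) = -3 · Y · H, and f 3 is
-- cancelled modulo 3.
3∣H-2f₂f₆ : ∀ n → + 3 ℤ∣.∣ (H +ˢ -ˢ (const (+ 2) *ˢ (f 2 *ˢ f 6))) n
3∣H-2f₂f₆ n = ∣-cancel (+ 3) (f 3) (H +ˢ -ˢ (const (+ 2) *ˢ (f 2 *ˢ f 6))) (suc n) (f-at-0 3)
  (λ m _ → subst (+ 3 ℤ∣.∣_) (sym (at multiple m)) (const-∣ (+ 3) (-ˢ (Y *ˢ H)) m)) n ℕₚ.≤-refl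
  where
  open ≈-Reasoning
  open SeriesSolver
  Y : Series
  Y = proj₁ (frobenius 1)
  multiple : f 3 *ˢ (H +ˢ -ˢ (const (+ 2) *ˢ (f 2 *ˢ f 6))) ≈ const (+ 3) *ˢ -ˢ (Y *ˢ H)
  multiple = begin
    f 3 *ˢ (H +ˢ -ˢ (const (+ 2) *ˢ (f 2 *ˢ f 6)))
      ≈⟨ solve 5 (λ f₃ h y f₂ f₆ → f₃ :* (h :+ :- (con (+ 2) :* (f₂ :* f₆)))
           := (f₃ :+ con (+ 3) :* y) :* h :+ :- (con (+ 2) :* (f₂ :* f₃ :* f₆)) :+ con (+ 3) :* (:- (y :* h))) S.refl
           (f 3) H Y (f 2) (f 6) ⟩
    (f 3 +ˢ const (+ 3) *ˢ Y) *ˢ H +ˢ -ˢ (const (+ 2) *ˢ (f 2 *ˢ f 3 *ˢ f 6)) +ˢ const (+ 3) *ˢ -ˢ (Y *ˢ H)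
      ≈⟨ S.+-congʳ (S.+-cong (S.trans (S.*-congʳ (S.sym (proj₂ (frobenius 1)))) H-product) S.refl) ⟩
    const (+ 2) *ˢ (f 2 *ˢ f 3 *ˢ f 6) +ˢ -ˢ (const (+ 2) *ˢ (f 2 *ˢ f 3 *ˢ f 6)) +ˢ const (+ 3) *ˢ -ˢ (Y *ˢ H)
      ≈⟨ S.trans (S.+-congʳ (S.-‿inverseʳ _)) (S.+-identityˡ _) ⟩
    const (+ 3) *ˢ -ˢ (Y *ˢ H) ∎

sumOver-mono-support : {A : Set} (xs : List A) (c : A → ℤ) (h : A → ℕ) (n : ℕ) →
  (Σ A λ x → h x ≡ n) ⊎ sumOver xs (λ x → mono (c x) (h x)) n ≡ + 0
sumOver-mono-support [] c h n = inj₂ (0ˢ-at n)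
sumOver-mono-support (x ∷ xs) c h n with h x ≟ n | sumOver-mono-support xs c h n
... | yes hx≡n | _ = inj₁ (x , hx≡n)
... | no _ | inj₁ witness = inj₁ witness
... | no hx≢n | inj₂ rest≡0 = inj₂ (trans (+ˢ-at _ _ n) (cong₂ Z._+_ (mono-off (c x) (h x) n hx≢n) rest≡0))

theta-support : ∀ ε a b n → (Σ ℤ λ j → exponent a b j ≡ n) ⊎ theta ε a b n ≡ + 0
theta-support ε a b n = sumOver-mono-support (range (suc n)) (λ j → ε Z.^ ∣ j ∣) (exponent a b) n

*ˢ-at-≡0 : ∀ X Y n → (∀ k l → k + l ≡ n → X k Z.* Y l ≡ + 0) → (X *ˢ Y) n ≡ + 0
*ˢ-at-≡0 X Y zero p = p 0 0 refl
*ˢ-at-≡0 X Y (suc n) p = cong₂ Z._+_ (p 0 (suc n) refl) (*ˢ-at-≡0 (tail X) Y n (λ k l eq → p (suc k) l (cong suc eq)))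

f₂f₆-vanishes : ∀ n → (∀ i j → ¬ exponent₂ 2 4 6 12 (i , j) ≡ n) → (f 2 *ˢ f 6) n ≡ + 0
f₂f₆-vanishes n no-solution = trans (at (S.*-cong (pentagonal 2) (pentagonal 6)) n) (*ˢ-at-≡0 _ _ n terms)
  where
  terms : ∀ k l → k + l ≡ n → theta -[1+ 0 ] 2 4 k Z.* theta -[1+ 0 ] 6 12 l ≡ + 0
  terms k l k+l≡n with theta-support -[1+ 0 ] 2 4 k | theta-support -[1+ 0 ] 6 12 l
  ... | inj₂ ≡0 | _ = trans (cong (Z._* theta -[1+ 0 ] 6 12 l) ≡0) (ℤₚ.*-zeroˡ (theta -[1+ 0 ] 6 12 l))
  ... | _ | inj₂ ≡0 = trans (cong (Z._*_ (theta -[1+ 0 ] 2 4 k)) ≡0) (ℤₚ.*-zeroʳ (theta -[1+ 0 ] 2 4 k))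
  ... | inj₁ (i , eᵢ) | inj₁ (j , eⱼ) = contradiction (trans (cong₂ _+_ eᵢ eⱼ) k+l≡n) (no-solution i j)

-- Powers of 5 and the norm form x² + 3y²

5^odd : ℕ → ℕ
5^odd α = 5 ^ (2 * α + 1)

5^odd-suc : ∀ α → 5^odd (suc α) ≡ 25 * 5^odd α
5^odd-suc α = trans (cong (5 ^_) (exponents α)) (product (5 ^ (2 * α + 1)))
  where
  exponents : ∀ α → 2 * suc α + 1 ≡ 2 + (2 * α + 1)
  exponents = solve-∀
  product : ∀ x → 5 * (5 * x) ≡ 25 * x
  product = solve-∀

-- −3 is not a square modulo 5.
5∣x²+3y² : ∀ x y → 5 ∣ x * x + 3 * (y * y) → (5 ∣ x) × (5 ∣ y)
5∣x²+3y² x y 5∣ with x divMod 5 | y divMod 5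
... | result q r refl | result t s refl =
  residue r q (proj₁ (residues r s 5∣r²+3s²)) , residue s t (proj₂ (residues r s 5∣r²+3s²))
  where
  residue : ∀ r q → 5 ∣ toℕ {5} r → 5 ∣ toℕ r + q * 5
  residue r q 5∣r = ℕ∣.∣m∣n⇒∣m+n 5∣r (ℕ∣.n∣m*n q)
  expand : ∀ r q s t → (r + q * 5) * (r + q * 5) + 3 * ((s + t * 5) * (s + t * 5))
    ≡ (2 * r * q + 5 * (q * q) + 3 * (2 * s * t + 5 * (t * t))) * 5 + (r * r + 3 * (s * s))
  expand = solve-∀
  5∣r²+3s² : 5 ∣ toℕ r * toℕ r + 3 * (toℕ s * toℕ s)
  5∣r²+3s² = ℕ∣.∣m+n∣m⇒∣n (subst (5 ∣_) (expand (toℕ r) q (toℕ s) t) 5∣)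
    (ℕ∣.n∣m*n (2 * toℕ r * q + 5 * (q * q) + 3 * (2 * toℕ s * t + 5 * (t * t))))
  residues : ∀ (r s : Fin 5) → 5 ∣ toℕ r * toℕ r + 3 * (toℕ s * toℕ s) → (5 ∣ toℕ r) × (5 ∣ toℕ s)
  residues = from-yes (Finₚ.all? {P = λ (r : Fin 5) → ∀ (s : Fin 5) → 5 ∣ toℕ r * toℕ r + 3 * (toℕ s * toℕ s) → (5 ∣ toℕ r) × (5 ∣ toℕ s)}
    λ r → Finₚ.all? λ s →
    (5 ∣? toℕ r * toℕ r + 3 * (toℕ s * toℕ s)) →-dec ((5 ∣? toℕ r) ×-dec (5 ∣? toℕ s)))

-- Descent on α: 5 divides the norm, hence x and y, and dividing both by 5 removes 25 from the
-- equation. At α = 0 only one 5 stands beside v, so the other one divides v.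
norm-valuation : ∀ α v x y → x * x + 3 * (y * y) ≡ 5^odd α * v → 5 ∣ v
norm-valuation α v x y eq = reduce α eq (5∣x²+3y² x y (subst (5 ∣_) (sym eq) (ℕ∣.∣m⇒∣m*n v 5∣5^odd)))
  where
  5∣5^odd : 5 ∣ 5^odd α
  5∣5^odd = subst (λ e → 5 ∣ 5 ^ e) (ℕₚ.+-comm 1 (2 * α)) (ℕ∣.m∣m*n (5 ^ (2 * α)))
  scale : ∀ x y → x * 5 * (x * 5) + 3 * (y * 5 * (y * 5)) ≡ 25 * (x * x + 3 * (y * y))
  scale = solve-∀
  reassoc : ∀ a v → 25 * a * v ≡ 25 * (a * v)
  reassoc = solve-∀
  factor5 : ∀ s → 25 * s ≡ 5 * (s * 5)
  factor5 = solve-∀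
  reduce : ∀ α {x y} → x * x + 3 * (y * y) ≡ 5^odd α * v → (5 ∣ x) × (5 ∣ y) → 5 ∣ v
  reduce zero eq (ℕ∣.divides x refl , ℕ∣.divides y refl) = ℕ∣.divides (x * x + 3 * (y * y)) (ℕₚ.*-cancelˡ-≡ v _ 5
    (trans (sym eq) (trans (scale x y) (factor5 (x * x + 3 * (y * y))))))
  reduce (suc α) eq (ℕ∣.divides x refl , ℕ∣.divides y refl) = norm-valuation α v x y (ℕₚ.*-cancelˡ-≡ _ _ 25
    (trans (sym (scale x y)) (trans eq (trans (cong (_* v) (5^odd-suc α)) (reassoc (5^odd α) v)))))

∣z∣² : ∀ z → + (∣ z ∣ * ∣ z ∣) ≡ z Z.* z
∣z∣² (+ n) = ℤₚ.pos-* n n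
∣z∣² -[1+ n ] = refl

-- Completing the squares in the exponents 3 i² - i and 9 j² - 3 j: 12 (3 i² - i + 9 j² - 3 j) + 4 =
-- (6 i - 1)² + 3 (6 j - 1)².
no-solution : ∀ M → (∀ x y → ¬ x * x + 3 * (y * y) ≡ 4 * (6 * M + 1)) → ∀ i j → ¬ exponent₂ 2 4 6 12 (i , j) ≡ 2 * M
no-solution M no-norm i j eq = no-norm ∣ z i ∣ ∣ z j ∣ (ℤₚ.+-injective (begin
  + (∣ z i ∣ * ∣ z i ∣ + 3 * (∣ z j ∣ * ∣ z j ∣)) ≡⟨ ℤₚ.pos-+ (∣ z i ∣ * ∣ z i ∣) _ ⟩
  + (∣ z i ∣ * ∣ z i ∣) Z.+ + (3 * (∣ z j ∣ * ∣ z j ∣))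
    ≡⟨ cong₂ Z._+_ (∣z∣² (z i)) (trans (ℤₚ.pos-* 3 (∣ z j ∣ * ∣ z j ∣)) (cong (Z._*_ (+ 3)) (∣z∣² (z j)))) ⟩
  z i Z.* z i Z.+ + 3 Z.* (z j Z.* z j) ≡⟨ complete i j ⟩
  + 6 Z.* (quadratic 2 4 i Z.+ quadratic 6 12 j) Z.+ + 4
    ≡⟨ cong (λ x → + 6 Z.* x Z.+ + 4) (trans (sym (exponent₂-ℤ 2 4 6 12 (i , j))) (cong (λ m → + 2 Z.* + m) eq)) ⟩
  + 6 Z.* (+ 2 Z.* + (2 * M)) Z.+ + 4 ≡⟨ cong (λ x → + 6 Z.* x Z.+ + 4) (sym (ℤₚ.pos-* 2 (2 * M))) ⟩
  + 6 Z.* + (2 * (2 * M)) Z.+ + 4 ≡⟨ cong (Z._+ + 4) (sym (ℤₚ.pos-* 6 (2 * (2 * M)))) ⟩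
  + (6 * (2 * (2 * M)) + 4) ≡⟨ cong +_ (collect M) ⟩
  + (4 * (6 * M + 1)) ∎))
  where
  open ≡-Reasoning
  z : ℤ → ℤ
  z i = + 6 Z.* i Z.- + 1
  collect : ∀ M → 6 * (2 * (2 * M)) + 4 ≡ 4 * (6 * M + 1)
  collect = solve-∀
  complete : ∀ i j → (+ 6 Z.* i Z.- + 1) Z.* (+ 6 Z.* i Z.- + 1) Z.+ + 3 Z.* ((+ 6 Z.* j Z.- + 1) Z.* (+ 6 Z.* j Z.- + 1)) ≡
    + 6 Z.* ((+ 2 Z.* (i Z.* (i Z.+ + 1)) Z.+ + 4 Z.* (i Z.* (i Z.- + 1))) Z.+
      (+ 6 Z.* (j Z.* (j Z.+ + 1)) Z.+ + 12 Z.* (j Z.* (j Z.- + 1)))) Z.+ + 4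
  complete = ℤTactic.solve-∀

6∣RD49 : ∀ M → (∀ x y → ¬ x * x + 3 * (y * y) ≡ 4 * (6 * M + 1)) → 6 ∣ RD49 (2 + 2 * M * 3)
6∣RD49 M no-norm = 6∣ (ℤ∣.∣⇒∣ᵤ (2∣H (2 * M))) (ℤ∣.∣⇒∣ᵤ 3∣H)
  where
  vanishes : (const (+ 2) *ˢ (f 2 *ˢ f 6)) (2 * M) ≡ + 0
  vanishes = trans (const-*ˢ-at (+ 2) (f 2 *ˢ f 6) (2 * M))
    (cong (Z._*_ (+ 2)) (f₂f₆-vanishes (2 * M) (no-solution M no-norm)))

  3∣H : + 3 ℤ∣.∣ H (2 * M)
  3∣H = subst (+ 3 ℤ∣.∣_)
    (trans (+ˢ-at H _ (2 * M)) (trans (cong (Z._+_ (H (2 * M))) (trans (-ˢ-at _ (2 * M)) (cong Z.-_ vanishes)))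
      (ℤₚ.+-identityʳ (H (2 * M)))))
    (3∣H-2f₂f₆ (2 * M))

  6∣ : ∀ {n} → 2 ∣ n → 3 ∣ n → 6 ∣ n
  6∣ (ℕ∣.divides a refl) 3∣2a = subst (6 ∣_) (ℕₚ.*-comm 2 a)
    (ℕ∣.*-monoʳ-∣ 2 (coprime-divisor {3} {2} {a} (from-yes (coprime? 3 2)) (subst (3 ∣_) (ℕₚ.*-comm a 2) 3∣2a)))

-- Since 5² is 1 modulo 6, the argument of `RD49` in the theorem is 2 modulo 6, hence an even index
-- of H; K is absorbed into M.
5^even : ∀ α → Σ ℕ λ K → 5 ^ (2 * α + 2) ≡ 1 + 6 * K
5^even zero = 4 , refl
5^even (suc α) with K , eq ← 5^even α = 4 + 25 * K ,
  trans (cong (5 ^_) (exponents α)) (trans (cong (λ x → 5 * (5 * x)) eq) (product K))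
  where
  exponents : ∀ α → 2 * suc α + 2 ≡ 2 + (2 * α + 2)
  exponents = solve-∀
  product : ∀ K → 5 * (5 * (1 + 6 * K)) ≡ 1 + 6 * (4 + 25 * K)
  product = solve-∀

theorem4p1 : (α n i : ℕ) → 1 ≤ i → i ≤ 4 →
    6 ∣ RD49 (6 * 5 ^ (2 * α + 2) * n + 6 * 5 ^ (2 * α + 1) * i + 5 ^ (2 * α + 2) + 1)
theorem4p1 α n i 1≤i i≤4 = subst (λ m → 6 ∣ RD49 m) (sym index) (6∣RD49 M no-norm)
  where
  K = proj₁ (5^even α)
  M = 5 ^ (2 * α + 2) * n + 5^odd α * i + K

  index : 6 * 5 ^ (2 * α + 2) * n + 6 * 5^odd α * i + 5 ^ (2 * α + 2) + 1 ≡ 2 + 2 * M * 3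
  index = trans (cong (λ e → 6 * 5 ^ (2 * α + 2) * n + 6 * 5^odd α * i + e + 1) (proj₂ (5^even α)))
    (collect (5 ^ (2 * α + 2)) (5^odd α) n i K)
    where
    collect : ∀ p q n i K → 6 * p * n + 6 * q * i + (1 + 6 * K) + 1 ≡ 2 + 2 * (p * n + q * i + K) * 3
    collect = solve-∀

  -- 6 M + 1 is the argument of `RD49` less 1, and each of its summands contains 5^(2α+1). The
  -- cofactor 30 n + 6 i + 5 is i modulo 5.
  norm : 4 * (6 * M + 1) ≡ 5^odd α * (4 * (30 * n + 6 * i + 5))
  norm = trans (regroup (5 ^ (2 * α + 2)) (5^odd α) n i K)
    (trans (cong (λ e → 4 * (6 * (5 ^ (2 * α + 2) * n) + 6 * (5^odd α * i) + e)) (sym (proj₂ (5^even α))))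
    (trans (cong (λ p → 4 * (6 * (p * n) + 6 * (5^odd α * i) + p)) (cong (5 ^_) (ℕₚ.+-suc (2 * α) 1)))
      (factor-out (5^odd α) n i)))
    where
    regroup : ∀ p q n i K → 4 * (6 * (p * n + q * i + K) + 1) ≡ 4 * (6 * (p * n) + 6 * (q * i) + (1 + 6 * K))
    regroup = solve-∀
    factor-out : ∀ q n i → 4 * (6 * (5 * q * n) + 6 * (q * i) + 5 * q) ≡ q * (4 * (30 * n + 6 * i + 5))
    factor-out = solve-∀

  5∤4i : ∀ i → 1 ≤ i → i ≤ 4 → ¬ 5 ∣ 4 * i
  5∤4i 1 _ _ = from-no (5 ∣? 4)
  5∤4i 2 _ _ = from-no (5 ∣? 8)
  5∤4i 3 _ _ = from-no (5 ∣? 12)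
  5∤4i 4 _ _ = from-no (5 ∣? 16)
  5∤4i (suc (suc (suc (suc (suc _))))) _ (s≤s (s≤s (s≤s (s≤s ()))))

  no-norm : ∀ x y → ¬ x * x + 3 * (y * y) ≡ 4 * (6 * M + 1)
  no-norm x y eq = 5∤4i i 1≤i i≤4 (ℕ∣.∣m+n∣m⇒∣n
    (subst (5 ∣_) (split n i) (norm-valuation α (4 * (30 * n + 6 * i + 5)) x y (trans eq norm)))
    (ℕ∣.n∣m*n (24 * n + 4 * i + 4)))
    where
    split : ∀ n i → 4 * (30 * n + 6 * i + 5) ≡ (24 * n + 4 * i + 4) * 5 + 4 * i
    split = solve-∀
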